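{- Let $k\ge 1$ be a fixed integer. (1) $\mathrm{Cond}(V_{\Phi_n})$ is polynomially bounded in $n$ as $n$ ranges over the integers $n\ge 2$ having at most $k$ distinct prime divisors; that is, there are constants $C,c>0$ depending only on $k$ such that $\mathrm{Cond}(V_{\Phi_n})\le C n^{c}$ for all such $n$. (2) More generally, let $\mathcal{F}_k$ be a family of cyclotomic polynomials $\Phi_n$ ($n\ge 2$) such that each conductor $n$ is divisible by at most $k$ distinct primes, and let $r\ge 0$ be such that $A(n)=O(n^r)$ for $\Phi_n\in\mathcal{F}_k$. Then, for $\Phi_n\in\mathcal{F}_k$, $$\mathrm{Cond}(V_{\Phi_n})=O\left(n^{2^k+k+3+r}\right).$$
   Context: For $n\ge 2$, $\Phi_n$ is the $n$-th cyclotomic polynomial ($n$ is called its conductor), $m=\phi(n)$ its degree ($\phi$ is Euler's totient), and $\zeta_1,\dots,\zeta_m\in\mathbb{C}$ are the primitive $n$-th roots of unity (in any fixed order). $V_{\Phi_n}$ is the $m\times m$ Vandermonde matrix whose $(i,j)$ entry is $\zeta_i^{\,j-1}$, $1\le i,j\le m$. For a complex matrix $A=(a_{ij})$, $\|A\|=\sqrt{\sum_{i,j}|a_{ij}|^2}$ is the Frobenius norm, and for invertible $A$, $\mathrm{Cond}(A)=\|A\|\,\|A^{ -1}\|$. $A(n)$ denotes the maximum of the absolute values of the coefficients of $\Phi_n$. The implied constants in the $O$-notation do not depend on $n$ (they may depend on $k$, $r$ and the family). -}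

module Defs where

open import Algebra.Bundles using (CommutativeRing)
open import Algebra.Bundles.Raw using (RawRing)
import Algebra.Definitions.RawSemiring as RawSemiringDefs
open import Data.Bool.Base using (if_then_else_)
open import Data.Fin.Base as Fin using (Fin; toℕ)
import Data.Fin.Properties as Fin
open import Data.List.Base using (List; length; filter; map; upTo)
open import Data.Nat.Base as ℕ using (ℕ; zero; suc)
open import Data.Nat.Coprimality using (coprime?)
open import Data.Nat.Divisibility using (_∣?_)
open import Data.Nat.Primality using (prime?)
open import Data.Product.Base using (_×_; _,_; Σ-syntax; ∃-syntax; proj₁)
open import Data.Vec.Functional as Vector using (Vector)
open import Level using (Level) renaming (suc to lsuc)
open import Relation.Binary.Core using (Rel)
open import Relation.Binary.PropositionalEquality.Core using (_≡_)
open import Relation.Binary.Structures using (IsStrictTotalOrder)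
import Relation.Binary.Construct.StrictToNonStrict as StrictToNonStrict
open import Relation.Nullary.Decidable using (does; _×-dec_)
open import Relation.Nullary.Negation using (¬_)
open import Relation.Unary using (Pred)

-- Euler's totient: the number of 1 ≤ j ≤ n coprime to n.
φ : ℕ → ℕ
φ n = length (filter (λ j → coprime? j n) (map suc (upTo n)))

-- The number of distinct prime divisors of n; the search range
-- 0, …, n contains every divisor of n as soon as n ≥ 1.
ω : ℕ → ℕ
ω n = length (filter (λ p → prime? p ×-dec (p ∣? n)) (upTo (suc n)))

-- The axioms of the real numbers in their classical form: trichotomy
-- is assumed and every nonempty predicate which is bounded above has a
-- least upper bound.  They determine ℝ up to isomorphism.  As usual for
-- total versions of partial operations, `x ⁻¹` and `sup P` are
-- unspecified when x ≈ 0# or when P is empty or unbounded.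
record CompleteOrderedField (ℓ : Level) : Set (lsuc ℓ) where
  infix 4 _<_
  infix 9 _⁻¹
  field
    commutativeRing : CommutativeRing ℓ ℓ
  open CommutativeRing commutativeRing public
  field
    0≉1                : 0# ≉ 1#
    _⁻¹                : Carrier → Carrier
    ⁻¹-inverse         : ∀ x → x ≉ 0# → x * x ⁻¹ ≈ 1#
    _<_                : Rel Carrier ℓ
    isStrictTotalOrder : IsStrictTotalOrder _≈_ _<_
    +-monoˡ-<          : ∀ z {x y} → x < y → x + z < y + z
    *-positive         : ∀ {x y} → 0# < x → 0# < y → 0# < x * y

  open IsStrictTotalOrder isStrictTotalOrder public using (compare; _<?_)
  open StrictToNonStrict _≈_ _<_ public using (_≤_)

  UpperBound : Pred Carrier ℓ → Carrier → Set ℓ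
  UpperBound P b = ∀ {x} → P x → x ≤ b

  field
    sup       : Pred Carrier ℓ → Carrier
    sup-upper : ∀ P → ∃[ x ] P x → ∃[ b ] UpperBound P b → UpperBound P (sup P)
    sup-least : ∀ P → ∃[ x ] P x → ∀ {b} → UpperBound P b → sup P ≤ b

module Cyclotomic {ℓ : Level} (R : CompleteOrderedField ℓ) where

  open CompleteOrderedField R public
    using (_≈_; _+_; _*_; -_; 0#; 1#; _<_; _≤_; _<?_; sup)
    renaming (Carrier to ℝ)

  private
    module ℝ′ = RawSemiringDefs
      (RawRing.rawSemiring (CompleteOrderedField.rawRing R))

  infixr 8 _^_ _^ʳ_
  infixl 6 _⊔_

  _^_ : ℝ → ℕ → ℝ
  _^_ = ℝ′._^_

  fromℕ : ℕ → ℝ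
  fromℕ n = n ℝ′.× 1#

  _⊔_ : ℝ → ℝ → ℝ
  x ⊔ y = if does (x <? y) then y else x

  -- The nonnegative square root of x, for x ≥ 0.
  √_ : ℝ → ℝ
  √ x = sup (λ y → y * y ≤ x)

  -- The real power b ^ r, for b ≥ 1 and r ≥ 0 only: the supremum of
  -- the rational powers b ^ (p / q) with 0 ≤ p / q ≤ r, where
  -- b ^ (p / q) is the nonnegative y such that y ^ q = b ^ p.
  _^ʳ_ : ℝ → ℝ → ℝ
  b ^ʳ r = sup (λ y → ∃[ p ] ∃[ q ] (1 ℕ.≤ q) × (fromℕ p ≤ fromℕ q * r) ×
                                    (0# ≤ y) × (y ^ q ≈ b ^ p))

  record ℂ : Set ℓ where
    constructor _+i_
    field
      re im : ℝ
  open ℂ public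

  ℂ-rawRing : RawRing ℓ ℓ
  ℂ-rawRing = record
    { Carrier = ℂ
    ; _≈_     = λ z w → (re z ≈ re w) × (im z ≈ im w)
    ; _+_     = λ z w → (re z + re w) +i (im z + im w)
    ; _*_     = λ z w → (re z * re w + - (im z * im w)) +i
                        (re z * im w + im z * re w)
    ; -_      = λ z → (- re z) +i (- im z)
    ; 0#      = 0# +i 0#
    ; 1#      = 1# +i 0#
    }

  module ℂ′ where
    open RawRing ℂ-rawRing public
    open RawSemiringDefs rawSemiring public using (_^_; sum)

  ∣_∣ : ℂ → ℝ
  ∣ z ∣ = √ (re z ^ 2 + im z ^ 2)

  Matrix : ℕ → Set ℓ
  Matrix m = Fin m → Fin m → ℂ

  infix  4 _≈ᴹ_
  infixl 7 _*ᴹ_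

  _≈ᴹ_ : ∀ {m} → Matrix m → Matrix m → Set ℓ
  A ≈ᴹ B = ∀ i j → A i j ℂ′.≈ B i j

  _*ᴹ_ : ∀ {m} → Matrix m → Matrix m → Matrix m
  (A *ᴹ B) i j = ℂ′.sum (λ k → A i k ℂ′.* B k j)

  1ᴹ : ∀ {m} → Matrix m
  1ᴹ i j = if does (i Fin.≟ j) then ℂ′.1# else ℂ′.0#

  Invertible : ∀ {m} → Matrix m → Set ℓ
  Invertible {m} A = Σ[ B ∈ Matrix m ] (A *ᴹ B ≈ᴹ 1ᴹ) × (B *ᴹ A ≈ᴹ 1ᴹ)

  ‖_‖ : ∀ {m} → Matrix m → ℝ
  ‖ A ‖ = √ ℝ′.sum (λ i → ℝ′.sum (λ j → ∣ A i j ∣ ^ 2))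

  Cond : ∀ {m} (A : Matrix m) → Invertible A → ℝ
  Cond A A⁻¹ = ‖ A ‖ * ‖ proj₁ A⁻¹ ‖

  IsPrimitiveRoot : ℕ → ℂ → Set ℓ
  IsPrimitiveRoot n z =
    (z ℂ′.^ n ℂ′.≈ ℂ′.1#) ×
    (∀ d → 1 ℕ.≤ d → d ℕ.< n → ¬ (z ℂ′.^ d ℂ′.≈ ℂ′.1#))

  -- An ordering ζ₁, …, ζₘ, with m = φ n, of the primitive n-th roots
  -- of unity.
  record PrimitiveRoots (n : ℕ) : Set ℓ where
    field
      ζ           : Vector ℂ (φ n)
      primitivity : ∀ i → IsPrimitiveRoot n (ζ i)
      distinct    : ∀ {i j} → ζ i ℂ′.≈ ζ j → i ≡ j
      exhaustive  : ∀ z → IsPrimitiveRoot n z → ∃[ i ] z ℂ′.≈ ζ i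
  open PrimitiveRoots public using (ζ)

  -- A polynomial is given by its sequence of coefficients, the
  -- coefficient of xᵏ being the value at k.  The last two clauses
  -- expand (x - a) * p.
  ∏[x-_] : ∀ {m} → Vector ℂ m → (ℕ → ℂ)
  ∏[x-_] {zero}  a zero    = ℂ′.1#
  ∏[x-_] {zero}  a (suc k) = ℂ′.0#
  ∏[x-_] {suc m} a zero    =
    ℂ′.- (Vector.head a ℂ′.* ∏[x- Vector.tail a ] zero)
  ∏[x-_] {suc m} a (suc k) =
    ∏[x- Vector.tail a ] k ℂ′.+
    ℂ′.- (Vector.head a ℂ′.* ∏[x- Vector.tail a ] (suc k))

  -- Φ, A and V take the conductor n through the ordering ρ of the
  -- primitive n-th roots of unity; only V depends on the ordering.
  Φ : ∀ {n} → PrimitiveRoots n → (ℕ → ℂ)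
  Φ ρ = ∏[x- ζ ρ ]

  A : ∀ {n} → PrimitiveRoots n → ℝ
  A {n} ρ = Vector.foldr _⊔_ 0# {suc (φ n)} (λ k → ∣ Φ ρ (toℕ k) ∣)

  V : ∀ {n} → PrimitiveRoots n → Matrix (φ n)
  V ρ i j = ζ ρ i ℂ′.^ toℕ j

{-# OPTIONS --safe #-}
module Submission where

-- Put f = ∏ (1 - ζᵗ x) over the t ≤ n coprime to n, ζ a primitive n-th root of unity.
-- Sieving out the prime divisors p of n one at a time writes f as a product of 2^ω(n) factors
-- (1 - xᵉ)^±1, half of them with each sign.  Multiplication by 1 - xᵉ at most doubles the
-- coefficients, and division by it multiplies the first N of them by at most N, so
-- multiplying by f and dividing by f together cost a factor of at most (2N)^(2^ω(n)).
--
-- Multiplying f by 1/f truncated at degree K yields 1 - xᴷ h with deg h < φ(n), and f vanishes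
-- at every primitive root ζᵢ, so ζᵢ⁻ᴷ = h_K(ζᵢ) with the coefficients of h_K bounded as above
-- for K ≤ n.  Hence the polynomials (1/n) Σ_K ζᵢᴷ h_K (1 ≤ K ≤ n) take the values δᵢⱼ at the ζⱼ:
-- their coefficients are the entries of V⁻¹.  This gives Cond V = O(n^(2^k+2)).

open import Algebra.Bundles using (CommutativeRing)
open import Algebra.Bundles.Raw using (RawRing)
import Algebra.Properties.AbelianGroup as AbelianGroupProperties
import Algebra.Properties.CommutativeSemiring.Exp as CommutativeSemiringExp
import Algebra.Properties.Group as GroupProperties
import Algebra.Properties.Ring as RingProperties
import Algebra.Properties.Semiring.Exp as SemiringExp
import Algebra.Properties.Semiring.Mult as SemiringMult
import Algebra.Properties.Semiring.Mult.TCOptimised as SemiringMult′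
import Algebra.Properties.Semiring.Sum as SemiringSum
import Algebra.Solver.Ring as RingSolver
open import Algebra.Solver.Ring.AlmostCommutativeRing
  using (fromCommutativeRing; _-Raw-AlmostCommutative⟶_)
open import Data.Bool.Base using (if_then_else_)
open import Data.Fin.Base as Fin using (Fin; toℕ)
import Data.Fin.Properties as Fin
open import Data.Integer.Base as ℤ using (ℤ; -[1+_]; _⊖_)
import Data.Integer.Properties as ℤ
open import Data.List.Base using (List; []; _∷_; length; map; filter; upTo; downFrom)
open import Data.List.Membership.Propositional using (find; lose)
open import Data.List.Membership.Propositional.Properties using (∈-filter⁺; ∈-filter⁻; ∈-upTo⁺)
import Data.List.Properties as List
open import Data.List.Relation.Binary.Permutation.Propositional
  using (_↭_; ↭-reflexive; ↭-trans)
open import Data.List.Relation.Binary.Permutation.Propositional.Properties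
  using (filter-↭; map⁺; ↭-length; ↭-reverse)
open import Data.List.Relation.Unary.All as All using (All; []; _∷_)
open import Data.List.Relation.Unary.All.Properties using (all-filter)
open import Data.List.Relation.Unary.AllPairs using (_∷_)
open import Data.List.Relation.Unary.Any using (Any; here; there)
import Data.List.Relation.Unary.Any.Properties as Any
open import Data.List.Relation.Unary.Unique.Propositional using (Unique)
import Data.List.Relation.Unary.Unique.Propositional.Properties as Unique
open import Data.Maybe.Base as Maybe using (Maybe)
open import Data.Nat.Base as ℕ using (ℕ; zero; suc; s≤s; z≤n; NonZero)
open import Data.Nat.Coprimality as Coprime using (Coprime; coprime?)
open import Data.Nat.Divisibility
open import Data.Nat.ListAction using (product)
open import Data.Nat.Primality
  using (Prime; prime?; ¬prime[1]; euclidsLemma; prime⇒irreducible)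
open import Data.Nat.Primality.Factorisation using (factorise; PrimeFactorisation)
import Data.Nat.Properties as ℕ
open import Data.Nat.Solver using (module +-*-Solver)
open import Data.Product.Base using (_×_; _,_; Σ-syntax; ∃-syntax; proj₁; proj₂)
open import Data.Sum.Base using (_⊎_; inj₁; inj₂; [_,_]′)
open import Defs
open import Function.Base using (_∘_; _$_)
open import Level using (Level)
open import Relation.Binary.Bundles using (DecTotalOrder; StrictTotalOrder)
open import Relation.Binary.Definitions using (tri<; tri≈; tri>)
import Relation.Binary.Properties.StrictTotalOrder as StrictTotalOrderProperties
open import Relation.Binary.PropositionalEquality as ≡ using (_≡_; _≢_)
import Relation.Binary.Reasoning.Setoid as SetoidReasoning
import Relation.Binary.Reasoning.StrictPartialOrder as StrictReasoning
open import Relation.Nullary.Decidable using (Dec; yes; no; does; dec⇒maybe; ¬?; _×-dec_)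
open import Relation.Nullary.Negation using (¬_; contradiction)
open import Relation.Unary using (Pred; Decidable)

-- The textbook formula for V⁻¹ divides by the derivative of Φₙ at ζᵢ and would call for a lower
-- bound on it. Here the only denominator is n: the values at ζⱼ of the averaged polynomials are
-- means of the powers (ζᵢ / ζⱼ)ᴷ over a full period, so orthogonality of the n-th roots of unity
-- takes over the role of that division. The factors of f are 1 - a x rather than x - a because a
-- constant term 1 makes them invertible on power series. A bound for multiplication alone does not
-- survive the sieve. A sieving step expresses an operator as a quotient of two others, and the
-- quotient multiplies by one and divides by the other; hence bounds for multiplication and for
-- division travel together. Division is bounded only on a finite window of N coefficients. The
-- product of f and the truncated 1/f is read below degree φ(n) + n, whence N = 2n and the factor
-- (4n)^(2^k). The remaining n² comes from the two Frobenius norms, each of which contributes the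
-- dimension φ(n) ≤ n.

-- Integer constants for the ring solver over a commutative ring

module IntegerCoefficients {c ℓ} (K : CommutativeRing c ℓ) where
  open CommutativeRing K
  open RingProperties ring
  open AbelianGroupProperties +-abelianGroup
  open SemiringMult′ semiring
    using (×-homo-+; ×1-homo-*; 1+×) renaming (_×_ to _·_)
  open SetoidReasoning setoid

  -- With the optimised multiple, the literals 0 and 1 of the solver unfold definitionally to `0#`
  -- and `1#`, so solved equations match the goals without conversion.
  ⟦_⟧ᶻ : ℤ → Carrier
  ⟦ ℤ.+ n ⟧ᶻ    = n · 1#
  ⟦ -[1+ n ] ⟧ᶻ = - (suc n · 1#)

  ⟦⟧-neg : ∀ i → ⟦ ℤ.- i ⟧ᶻ ≈ - ⟦ i ⟧ᶻ
  ⟦⟧-neg (ℤ.+ zero)  = sym ε⁻¹≈ε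
  ⟦⟧-neg (ℤ.+ suc n) = refl
  ⟦⟧-neg -[1+ n ]    = sym (⁻¹-involutive _)

  1+x-1+y : ∀ x y → (1# + x) - (1# + y) ≈ x - y
  1+x-1+y x y = begin
    (1# + x) + - (1# + y)      ≈⟨ +-cong (+-comm _ _) (sym (⁻¹-∙-comm _ _)) ⟩
    (x + 1#) + (- 1# + - y)    ≈⟨ +-assoc _ _ _ ⟩
    x + (1# + (- 1# + - y))    ≈⟨ +-congˡ (sym (+-assoc _ _ _)) ⟩
    x + ((1# + - 1#) + - y)    ≈⟨ +-congˡ (+-congʳ (-‿inverseʳ _)) ⟩
    x + (0# + - y)             ≈⟨ +-congˡ (+-identityˡ _) ⟩
    x - y                      ∎

  ⟦⟧-⊖ : ∀ m n → ⟦ m ⊖ n ⟧ᶻ ≈ m · 1# - n · 1#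
  ⟦⟧-⊖ m       zero    = sym (trans (+-congˡ ε⁻¹≈ε) (+-identityʳ _))
  ⟦⟧-⊖ zero    (suc n) = sym (+-identityˡ _)
  ⟦⟧-⊖ (suc m) (suc n) = begin
    ⟦ suc m ⊖ suc n ⟧ᶻ     ≡⟨ ≡.cong ⟦_⟧ᶻ (ℤ.[1+m]⊖[1+n]≡m⊖n m n) ⟩
    ⟦ m ⊖ n ⟧ᶻ             ≈⟨ ⟦⟧-⊖ m n ⟩
    m · 1# - n · 1#        ≈⟨ 1+x-1+y _ _ ⟨
    (1# + m · 1#) - (1# + n · 1#) ≈⟨ +-cong (1+× m 1#) (-‿cong (1+× n 1#)) ⟨
    suc m · 1# - suc n · 1# ∎

  ⟦⟧-+ : ∀ i j → ⟦ i ℤ.+ j ⟧ᶻ ≈ ⟦ i ⟧ᶻ + ⟦ j ⟧ᶻ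
  ⟦⟧-+ (ℤ.+ m)  (ℤ.+ n)  = ×-homo-+ 1# m n
  ⟦⟧-+ (ℤ.+ m)  -[1+ n ] = ⟦⟧-⊖ m (suc n)
  ⟦⟧-+ -[1+ m ] (ℤ.+ n)  = trans (⟦⟧-⊖ n (suc m)) (+-comm _ _)
  ⟦⟧-+ -[1+ m ] -[1+ n ] = begin
    - (suc (suc (m ℕ.+ n)) · 1#)       ≡⟨ ≡.cong (λ k → - (suc k · 1#)) (≡.sym (ℕ.+-suc m n)) ⟩
    - ((suc m ℕ.+ suc n) · 1#)         ≈⟨ -‿cong (×-homo-+ 1# (suc m) (suc n)) ⟩
    - (suc m · 1# + suc n · 1#)        ≈⟨ ⁻¹-∙-comm _ _ ⟨
    - (suc m · 1#) + - (suc n · 1#)    ∎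

  ⟦⟧-*-+ : ∀ m j → ⟦ ℤ.+ m ℤ.* j ⟧ᶻ ≈ m · 1# * ⟦ j ⟧ᶻ
  ⟦⟧-*-+ m (ℤ.+ n)  = trans (reflexive (≡.cong ⟦_⟧ᶻ (≡.sym (ℤ.pos-* m n)))) (×1-homo-* m n)
  ⟦⟧-*-+ m -[1+ n ] = begin
    ⟦ ℤ.+ m ℤ.* -[1+ n ] ⟧ᶻ      ≡⟨ ≡.cong ⟦_⟧ᶻ (≡.sym (ℤ.neg-distribʳ-* (ℤ.+ m) (ℤ.+ suc n))) ⟩
    ⟦ ℤ.- (ℤ.+ m ℤ.* ℤ.+ suc n) ⟧ᶻ ≈⟨ ⟦⟧-neg (ℤ.+ m ℤ.* ℤ.+ suc n) ⟩
    - ⟦ ℤ.+ m ℤ.* ℤ.+ suc n ⟧ᶻ   ≈⟨ -‿cong (⟦⟧-*-+ m (ℤ.+ suc n)) ⟩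
    - (m · 1# * (suc n · 1#))      ≈⟨ -‿distribʳ-* _ _ ⟩
    m · 1# * - (suc n · 1#)        ∎

  ⟦⟧-* : ∀ i j → ⟦ i ℤ.* j ⟧ᶻ ≈ ⟦ i ⟧ᶻ * ⟦ j ⟧ᶻ
  ⟦⟧-* (ℤ.+ m)  j = ⟦⟧-*-+ m j
  ⟦⟧-* -[1+ m ] j = begin
    ⟦ -[1+ m ] ℤ.* j ⟧ᶻ            ≡⟨ ≡.cong ⟦_⟧ᶻ (≡.sym (ℤ.neg-distribˡ-* (ℤ.+ suc m) j)) ⟩
    ⟦ ℤ.- (ℤ.+ suc m ℤ.* j) ⟧ᶻ      ≈⟨ ⟦⟧-neg (ℤ.+ suc m ℤ.* j) ⟩
    - ⟦ ℤ.+ suc m ℤ.* j ⟧ᶻ          ≈⟨ -‿cong (⟦⟧-*-+ (suc m) j) ⟩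
    - (suc m · 1# * ⟦ j ⟧ᶻ)         ≈⟨ -‿distribˡ-* _ _ ⟩
    - (suc m · 1#) * ⟦ j ⟧ᶻ         ∎

  homomorphism : ℤ.+-*-rawRing -Raw-AlmostCommutative⟶
                 fromCommutativeRing K
  homomorphism = record
    { ⟦_⟧    = ⟦_⟧ᶻ
    ; +-homo = ⟦⟧-+
    ; *-homo = ⟦⟧-*
    ; -‿homo = ⟦⟧-neg
    ; 0-homo = refl
    ; 1-homo = refl
    }

  ⟦⟧-≟ : ∀ i j → Maybe (⟦ i ⟧ᶻ ≈ ⟦ j ⟧ᶻ)
  ⟦⟧-≟ i j = Maybe.map (λ i≡j → reflexive (≡.cong ⟦_⟧ᶻ i≡j)) (dec⇒maybe (i ℤ.≟ j))

  module Solver = RingSolver ℤ.+-*-rawRing (fromCommutativeRing K) homomorphism ⟦⟧-≟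

-- Power series and products of factors 1 - a x

module PowerSeries {c ℓ} (K : CommutativeRing c ℓ) where
  open CommutativeRing K hiding (zero)
  open RingProperties ring using (-0#≈0#)
  open GroupProperties +-group using () renaming (∙-cancelʳ to +-cancelʳ)
  open SemiringExp semiring using (_^_)
  open IntegerCoefficients K using (module Solver)
  open Solver using (solve; _:=_; _:+_; _:*_; _:-_; :-_; con)
  open SetoidReasoning setoid

  infix 4 _≋_

  Series : Set c
  Series = ℕ → Carrier

  _≋_ : Series → Series → Set ℓ
  s ≋ t = ∀ k → s k ≈ t k

  ≋-sym : ∀ {s t} → s ≋ t → t ≋ s
  ≋-sym s≋t k = sym (s≋t k)

  ≋-trans : ∀ {s t u} → s ≋ t → t ≋ u → s ≋ u
  ≋-trans s≋t t≋u k = trans (s≋t k) (t≋u k)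

  𝟘 δ : Series
  𝟘 _ = 0#
  δ zero    = 1#
  δ (suc _) = 0#

  x-0#≈x : ∀ x → x - 0# ≈ x
  x-0#≈x x = trans (+-congˡ -0#≈0#) (+-identityʳ x)

  -- T a is multiplication by 1 - a x.
  T : Carrier → Series → Series
  T a s zero    = s zero
  T a s (suc k) = s (suc k) - a * s k

  T-congʳ : ∀ a {s t} → s ≋ t → T a s ≋ T a t
  T-congʳ a s≋t zero    = s≋t zero
  T-congʳ a s≋t (suc k) = +-cong (s≋t (suc k)) (-‿cong (*-congˡ (s≋t k)))

  T-congˡ : ∀ {a b} s → a ≈ b → T a s ≋ T b s
  T-congˡ s a≈b zero    = refl
  T-congˡ s a≈b (suc k) = +-congˡ (-‿cong (*-congʳ a≈b))

  T-comm : ∀ a b s → T a (T b s) ≋ T b (T a s)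
  T-comm a b s zero          = refl
  T-comm a b s (suc zero)    =
    solve 4 (λ a b s₀ s₁ → (s₁ :- b :* s₀) :- a :* s₀ := (s₁ :- a :* s₀) :- b :* s₀)
      refl a b (s 0) (s 1)
  T-comm a b s (suc (suc k)) =
    solve 5 (λ a b s₀ s₁ s₂ → (s₂ :- b :* s₁) :- a :* (s₁ :- b :* s₀) :=
                              (s₂ :- a :* s₁) :- b :* (s₁ :- a :* s₀))
      refl a b (s k) (s (suc k)) (s (suc (suc k)))

  T⁻¹ : Carrier → Series → Series
  T⁻¹ a s zero    = s zero
  T⁻¹ a s (suc k) = s (suc k) + a * T⁻¹ a s k

  T-T⁻¹ : ∀ a s → T a (T⁻¹ a s) ≋ s
  T-T⁻¹ a s zero    = refl
  T-T⁻¹ a s (suc k) = solve 2 (λ x y → (x :+ y) :- y := x) refl (s (suc k)) (a * T⁻¹ a s k)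

  T-injective : ∀ a {s t} → T a s ≋ T a t → s ≋ t
  T-injective a eq zero    = eq zero
  T-injective a {s} {t} eq (suc k) = +-cancelʳ (- (a * s k)) _ _
    (trans (eq (suc k)) (+-congˡ (-‿cong (*-congˡ (sym (T-injective a eq k))))))

  T-𝟘 : ∀ a → T a 𝟘 ≋ 𝟘
  T-𝟘 a zero    = refl
  T-𝟘 a (suc k) = solve 1 (λ a → con ℤ.0ℤ :- a :* con ℤ.0ℤ := con ℤ.0ℤ) refl a

  ∏T : List Carrier → Series → Series
  ∏T []       s = s
  ∏T (a ∷ as) s = T a (∏T as s)

  ∏T-cong : ∀ as {s t} → s ≋ t → ∏T as s ≋ ∏T as t
  ∏T-cong []       s≋t = s≋t
  ∏T-cong (a ∷ as) s≋t = T-congʳ a (∏T-cong as s≋t)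

  T-∏T-comm : ∀ a bs s → T a (∏T bs s) ≋ ∏T bs (T a s)
  T-∏T-comm a []       s = λ _ → refl
  T-∏T-comm a (b ∷ bs) s = ≋-trans (T-comm a b _) (T-congʳ b (T-∏T-comm a bs s))

  ∏T⁻¹ : List Carrier → Series → Series
  ∏T⁻¹ []       s = s
  ∏T⁻¹ (a ∷ as) s = ∏T⁻¹ as (T⁻¹ a s)

  ∏T-∏T⁻¹ : ∀ as s → ∏T as (∏T⁻¹ as s) ≋ s
  ∏T-∏T⁻¹ []       s = λ _ → refl
  ∏T-∏T⁻¹ (a ∷ as) s = ≋-trans (T-congʳ a (∏T-∏T⁻¹ as _)) (T-T⁻¹ a s)

  ∏T-zeroth : ∀ as s → ∏T as s 0 ≈ s 0
  ∏T-zeroth []       s = refl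
  ∏T-zeroth (a ∷ as) s = ∏T-zeroth as s

  module _ {a p q r} {A : Set a} {P : Pred A p} {Q : Pred A q} {R : Pred A r}
           (P? : Decidable P) (Q? : Decidable Q) (R? : Decidable R)
           (Q⊆P : ∀ {x} → Q x → P x) (R⊆P : ∀ {x} → R x → P x)
           (P⊆Q∪R : ∀ {x} → P x → Q x ⊎ R x) (Q∩R : ∀ {x} → Q x → ¬ R x)
           (f : A → Carrier) where

    -- One step of the sieve in abstract form: P is the disjoint union of Q and R. Filtering keeps
    -- the order of `xs`, so a factor from R has to be commuted past those from Q.
    ∏T-filter-⊎ : ∀ xs s → ∏T (map f (filter P? xs)) s ≋
                  ∏T (map f (filter Q? xs)) (∏T (map f (filter R? xs)) s)
    ∏T-filter-⊎ []       s = λ _ → refl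
    ∏T-filter-⊎ (x ∷ xs) s with P? x | Q? x | R? x
    ... | _      | yes qx | yes rx = contradiction rx (Q∩R qx)
    ... | yes _  | yes _  | no _   = T-congʳ (f x) (∏T-filter-⊎ xs s)
    ... | yes _  | no _   | yes _  =
      ≋-trans (T-congʳ (f x) (∏T-filter-⊎ xs s)) (T-∏T-comm (f x) (map f (filter Q? xs)) (∏T (map f (filter R? xs)) s))
    ... | yes px | no ¬qx | no ¬rx with P⊆Q∪R px
    ...   | inj₁ qx = contradiction qx ¬qx
    ...   | inj₂ rx = contradiction rx ¬rx
    ∏T-filter-⊎ (x ∷ xs) s | no ¬px | yes qx | _      = contradiction (Q⊆P qx) ¬px
    ∏T-filter-⊎ (x ∷ xs) s | no ¬px | no _   | yes rx = contradiction (R⊆P rx) ¬px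
    ∏T-filter-⊎ (x ∷ xs) s | no _   | no _   | no _   = ∏T-filter-⊎ xs s

  Supp : ℕ → Series → Set ℓ
  Supp N s = ∀ {k} → N ℕ.≤ k → s k ≈ 0#

  Supp-T : ∀ {N} a {s} → Supp N s → Supp (suc N) (T a s)
  Supp-T a {s} supp {suc k} (s≤s N≤k) = begin
    s (suc k) - a * s k  ≈⟨ +-cong (supp (ℕ.m≤n⇒m≤1+n N≤k)) (-‿cong (*-congˡ (supp N≤k))) ⟩
    0# - a * 0#          ≈⟨ T-𝟘 a 1 ⟩
    0#                   ∎

  Supp-∏T : ∀ as {N s} → Supp N s → Supp (length as ℕ.+ N) (∏T as s)
  Supp-∏T []       supp = supp
  Supp-∏T (a ∷ as) supp = Supp-T a (Supp-∏T as supp)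

  Supp-δ : Supp 1 δ
  Supp-δ {suc k} _ = refl

  truncate : ℕ → Series → Series
  truncate K s k with k ℕ.<? K
  ... | yes _ = s k
  ... | no  _ = 0#

  truncate-< : ∀ {K} s {k} → k ℕ.< K → truncate K s k ≈ s k
  truncate-< {K} s {k} k<K with k ℕ.<? K
  ... | yes _   = refl
  ... | no  k≮K = contradiction k<K k≮K

  truncate-Supp : ∀ {K} s → Supp K (truncate K s)
  truncate-Supp {K} s {k} K≤k with k ℕ.<? K
  ... | yes k<K = contradiction K≤k (ℕ.<⇒≱ k<K)
  ... | no  _   = refl

  -- A coefficient of a product involves only coefficients of equal or lower degree. Thus truncating
  -- 1/f at degree K is invisible below K, where the product with f is still 1.
  ∏T-local : ∀ as {K s t} → (∀ {k} → k ℕ.< K → s k ≈ t k) →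
             ∀ {k} → k ℕ.< K → ∏T as s k ≈ ∏T as t k
  ∏T-local []       s≈t         k<K = s≈t k<K
  ∏T-local (a ∷ as) s≈t {zero}  k<K = ∏T-local as s≈t k<K
  ∏T-local (a ∷ as) s≈t {suc k} k<K =
    +-cong (∏T-local as s≈t k<K) (-‿cong (*-congˡ (∏T-local as s≈t (ℕ.<⇒≤ k<K))))

  eval : ℕ → Series → Carrier → Carrier
  eval zero    s x = 0#
  eval (suc N) s x = eval N s x + s N * x ^ N

  eval-cong : ∀ N {s t} x → (∀ {k} → k ℕ.< N → s k ≈ t k) → eval N s x ≈ eval N t x
  eval-cong zero    x eq = refl
  eval-cong (suc N) x eq = +-cong (eval-cong N x (eq ∘ ℕ.m<n⇒m<1+n)) (*-congʳ (eq ℕ.≤-refl))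

  eval-𝟘 : ∀ N x → eval N 𝟘 x ≈ 0#
  eval-𝟘 zero    x = refl
  eval-𝟘 (suc N) x = trans (+-cong (eval-𝟘 N x) (zeroˡ _)) (+-identityʳ _)

  -- The extra term is the coefficient of degree N that `T a s` keeps and `eval N s` cuts off; it
  -- vanishes for polynomials of degree below N.
  eval-T : ∀ N a s x → eval (suc N) (T a s) x ≈ (1# - a * x) * eval N s x + s N * x ^ N
  eval-T zero    a s x = +-congʳ (sym (zeroʳ _))
  eval-T (suc N) a s x = trans (+-congʳ (eval-T N a s x))
    (solve 6 (λ a x E s₀ s₁ y →
        ((con ℤ.1ℤ :- a :* x) :* E :+ s₀ :* y) :+ (s₁ :- a :* s₀) :* (x :* y) :=
        (con ℤ.1ℤ :- a :* x) :* (E :+ s₀ :* y) :+ s₁ :* (x :* y))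
      refl a x (eval N s x) (s N) (s (suc N)) (x ^ N))

  eval-T-Supp : ∀ {N} a s x → Supp N s → eval (suc N) (T a s) x ≈ (1# - a * x) * eval N s x
  eval-T-Supp {N} a s x supp = begin
    eval (suc N) (T a s) x                      ≈⟨ eval-T N a s x ⟩
    (1# - a * x) * eval N s x + s N * x ^ N     ≈⟨ +-congˡ (trans (*-congʳ (supp ℕ.≤-refl)) (zeroˡ _)) ⟩
    (1# - a * x) * eval N s x + 0#              ≈⟨ +-identityʳ _ ⟩
    (1# - a * x) * eval N s x                   ∎

  eval-∏T-root : ∀ {as N s x} → Supp N s → Any (λ a → a * x ≈ 1#) as →
                 eval (length as ℕ.+ N) (∏T as s) x ≈ 0#
  eval-∏T-root {a ∷ as} {N} {s} {x} supp (here ax≈1) = begin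
    eval (suc (length as ℕ.+ N)) (T a (∏T as s)) x  ≈⟨ eval-T-Supp a _ x (Supp-∏T as supp) ⟩
    (1# - a * x) * eval (length as ℕ.+ N) (∏T as s) x               ≈⟨ *-congʳ (+-congˡ (-‿cong ax≈1)) ⟩
    (1# - 1#) * eval (length as ℕ.+ N) (∏T as s) x                  ≈⟨ *-congʳ (-‿inverseʳ 1#) ⟩
    0# * eval (length as ℕ.+ N) (∏T as s) x                         ≈⟨ zeroˡ _ ⟩
    0#                                              ∎
  eval-∏T-root {a ∷ as} {N} {s} {x} supp (there root) = begin
    eval (suc (length as ℕ.+ N)) (T a (∏T as s)) x  ≈⟨ eval-T-Supp a _ x (Supp-∏T as supp) ⟩
    (1# - a * x) * eval (length as ℕ.+ N) (∏T as s) x               ≈⟨ *-congˡ (eval-∏T-root supp root) ⟩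
    (1# - a * x) * 0#                               ≈⟨ zeroʳ _ ⟩
    0#                                              ∎

  shift : ℕ → Series → Series
  shift zero    s k       = s k
  shift (suc e) s zero    = 0#
  shift (suc e) s (suc k) = shift e s k

  conv : Series → Series → Series
  conv p s zero    = p zero * s zero
  conv p s (suc k) = p zero * s (suc k) + conv (p ∘ suc) s k

  conv-cong : ∀ {p q} s → p ≋ q → conv p s ≋ conv q s
  conv-cong s p≋q zero    = *-congʳ (p≋q 0)
  conv-cong s p≋q (suc k) = +-cong (*-congʳ (p≋q 0)) (conv-cong s (p≋q ∘ suc) k)

  conv-𝟘 : ∀ s → conv 𝟘 s ≋ 𝟘
  conv-𝟘 s zero    = zeroˡ _
  conv-𝟘 s (suc k) = trans (+-cong (zeroˡ _) (conv-𝟘 s k)) (+-identityʳ _)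

  conv-δ : ∀ s → conv δ s ≋ s
  conv-δ s zero    = *-identityˡ _
  conv-δ s (suc k) = trans (+-cong (*-identityˡ _) (conv-𝟘 s k)) (+-identityʳ _)

  conv-linear : ∀ p a q s k → conv (λ j → p j - a * q j) s k ≈ conv p s k - a * conv q s k
  conv-linear p a q s zero    =
    solve 4 (λ p a q s → (p :- a :* q) :* s := p :* s :- a :* (q :* s)) refl (p 0) a (q 0) (s 0)
  conv-linear p a q s (suc k) =
    trans (+-congˡ (conv-linear (p ∘ suc) a (q ∘ suc) s k))
    (solve 6 (λ p a q s u v → (p :- a :* q) :* s :+ (u :- a :* v) := (p :* s :+ u) :- a :* (q :* s :+ v))
      refl (p 0) a (q 0) (s (suc k)) (conv (p ∘ suc) s k) (conv (q ∘ suc) s k))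

  conv-T : ∀ a p s → conv (T a p) s ≋ T a (conv p s)
  conv-T a p s zero    = refl
  conv-T a p s (suc k) = trans (+-congˡ (conv-linear (p ∘ suc) a p s k)) (sym (+-assoc _ _ _))

  conv-∏T : ∀ as p s → conv (∏T as p) s ≋ ∏T as (conv p s)
  conv-∏T []       p s = λ _ → refl
  conv-∏T (a ∷ as) p s = ≋-trans (conv-T a _ s) (T-congʳ a (conv-∏T as p s))

  conv-shift-δ : ∀ e s → conv (shift e δ) s ≋ shift e s
  conv-shift-δ zero    s k       = conv-δ s k
  conv-shift-δ (suc e) s zero    = zeroˡ _
  conv-shift-δ (suc e) s (suc k) = trans (+-cong (zeroˡ _) (conv-shift-δ e s k)) (+-identityˡ _)

  -- `∏T as` is the Cauchy product with the single series `∏T as δ`, so an identity between such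
  -- operators may be checked on the series 1.
  ∏T-via-δ : ∀ as e → ∏T as δ ≋ (λ k → δ k - shift e δ k) → ∀ s → ∏T as s ≋ (λ k → s k - shift e s k)
  ∏T-via-δ as e eq s k = begin
    ∏T as s k                                    ≈⟨ ∏T-cong as (≋-sym (conv-δ s)) k ⟩
    ∏T as (conv δ s) k                           ≈⟨ conv-∏T as δ s k ⟨
    conv (∏T as δ) s k                           ≈⟨ conv-cong s eq k ⟩
    conv (λ j → δ j - shift e δ j) s k           ≈⟨ conv-cong s (λ j → +-congˡ (-‿cong (sym (*-identityˡ _)))) k ⟩
    conv (λ j → δ j - 1# * shift e δ j) s k      ≈⟨ conv-linear δ 1# (shift e δ) s k ⟩
    conv δ s k - 1# * conv (shift e δ) s k       ≈⟨ +-cong (conv-δ s k) (-‿cong (trans (*-identityˡ _) (conv-shift-δ e s k))) ⟩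
    s k - shift e s k                            ∎

  shift-δ-< : ∀ {e k} → k ℕ.< e → shift e δ k ≈ 0#
  shift-δ-< {suc e} {zero}  _         = refl
  shift-δ-< {suc e} {suc k} (s≤s k<e) = shift-δ-< k<e

  shift-δ-> : ∀ {e k} → e ℕ.< k → shift e δ k ≈ 0#
  shift-δ-> {zero}  {suc k} _         = refl
  shift-δ-> {suc e} {suc k} (s≤s e<k) = shift-δ-> e<k

  shift-δ-≡ : ∀ e → shift e δ e ≈ 1#
  shift-δ-≡ zero    = refl
  shift-δ-≡ (suc e) = shift-δ-≡ e

  -- The substitution of η x for x.
  scale : Carrier → Series → Series
  scale η s k = η ^ k * s k

  scale-T : ∀ η a s → scale η (T a s) ≋ T (η * a) (scale η s)
  scale-T η a s zero    = refl
  scale-T η a s (suc k) =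
    solve 5 (λ η a s₀ s₁ y → (η :* y) :* (s₁ :- a :* s₀) := (η :* y) :* s₁ :- (η :* a) :* (y :* s₀))
      refl η a (s k) (s (suc k)) (η ^ k)

  scale-δ : ∀ η → scale η δ ≋ δ
  scale-δ η zero    = *-identityʳ _
  scale-δ η (suc k) = zeroʳ _

  powers : Carrier → ℕ → List Carrier
  powers η zero    = []
  powers η (suc e) = η ^ suc e ∷ powers η e

  length-powers : ∀ η e → length (powers η e) ≡ e
  length-powers η zero    = ≡.refl
  length-powers η (suc e) = ≡.cong suc (length-powers η e)

  -- The substitution raises the exponents 1, ..., e of the factors to 2, ..., e + 1. The factor
  -- with exponent 1 on the left and the one with exponent e + 1 on the right complete both sides to
  -- the same product, which avoids a division.
  scale-∏T-powers : ∀ η e s →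
    T (η ^ 1) (scale η (∏T (powers η e) s)) ≋ T (η ^ suc e) (∏T (powers η e) (scale η s))
  scale-∏T-powers η zero    s = λ _ → refl
  scale-∏T-powers η (suc e) s =
    ≋-trans (T-congʳ (η ^ 1) (scale-T η (η ^ suc e) _))
    (≋-trans (T-comm (η ^ 1) (η ^ suc (suc e)) _)
    (T-congʳ (η ^ suc (suc e)) (scale-∏T-powers η e s)))

  -- The product ∏ (1 - ηᵗ x) over 1 ≤ t ≤ e is invariant under x ↦ η x, so only its
  -- coefficients of 1 and xᵉ survive; the factor t = e makes it vanish at x = 1.
  module _ (noZeroDivisors : ∀ {x y} → x * y ≈ 0# → x ≈ 0# ⊎ y ≈ 0#)
           {η : Carrier} {e : ℕ} (η^e≈1 : η ^ suc e ≈ 1#)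
           (η^k≉1 : ∀ {k} → 1 ℕ.≤ k → k ℕ.< suc e → ¬ (η ^ k ≈ 1#)) where

    private
      P u : Series
      P = ∏T (powers η (suc e)) δ
      u = ∏T (powers η e) δ

      scale-P : scale η P ≋ P
      scale-P = T-injective (η ^ 1)
        (≋-trans (scale-∏T-powers η (suc e) δ)
        -- The surplus factor on the right has exponent one more than the order of η, hence equals
        -- the one on the left and cancels.
        (≋-trans (T-congˡ _ (*-congˡ η^e≈1))
        (T-congʳ (η ^ 1) (∏T-cong (powers η (suc e)) (scale-δ η)))))

      P≈0 : ∀ {k} → 1 ℕ.≤ k → k ℕ.< suc e → P k ≈ 0#
      P≈0 {k} 1≤k k<e with noZeroDivisors {η ^ k - 1#} {P k}
        (begin
          (η ^ k - 1#) * P k  ≈⟨ solve 2 (λ x p → (x :- con ℤ.1ℤ) :* p := x :* p :- p) refl _ _ ⟩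
          η ^ k * P k - P k   ≈⟨ +-congʳ (scale-P k) ⟩
          P k - P k           ≈⟨ -‿inverseʳ _ ⟩
          0#                  ∎)
      ... | inj₂ Pk≈0 = Pk≈0
      ... | inj₁ η^k-1≈0 = contradiction
        (begin
          η ^ k                ≈⟨ solve 1 (λ x → x := (x :- con ℤ.1ℤ) :+ con ℤ.1ℤ) refl _ ⟩
          (η ^ k - 1#) + 1#    ≈⟨ +-congʳ η^k-1≈0 ⟩
          0# + 1#              ≈⟨ +-identityˡ 1# ⟩
          1#                   ∎) (η^k≉1 1≤k k<e)

      P-suc : ∀ k → P (suc k) ≈ u (suc k) - u k
      P-suc k = +-congˡ (-‿cong (trans (*-congʳ η^e≈1) (*-identityˡ _)))

      -- The factor of exponent `suc e` is 1 - x, so P = (1 - x) u. As P has no coefficients in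
      -- degrees 1 to e, u must be 1 + x + ... + xᵉ, and its top coefficient then yields the
      -- coefficient -1 of P in degree `suc e`.
      u≈1 : ∀ {k} → k ℕ.≤ e → u k ≈ 1#
      u≈1 {zero}  _     = ∏T-zeroth (powers η e) δ
      u≈1 {suc k} k<e = begin
        u (suc k)               ≈⟨ solve 2 (λ x y → x := (x :- y) :+ y) refl _ _ ⟩
        (u (suc k) - u k) + u k ≈⟨ +-cong (trans (sym (P-suc k)) (P≈0 (s≤s z≤n) (s≤s k<e))) (u≈1 (ℕ.<⇒≤ k<e)) ⟩
        0# + 1#                 ≈⟨ +-identityˡ _ ⟩
        1#                      ∎

      Supp-powers : ∀ m → Supp (suc m) (∏T (powers η m) δ)
      Supp-powers m = ≡.subst (λ N → Supp N (∏T (powers η m) δ))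
        (≡.trans (≡.cong (ℕ._+ 1) (length-powers η m)) (ℕ.+-comm m 1))
        (Supp-∏T (powers η m) Supp-δ)

    ∏T-powers-δ : ∏T (powers η (suc e)) δ ≋ (λ k → δ k - shift (suc e) δ k)
    ∏T-powers-δ zero    = trans (∏T-zeroth (powers η e) δ) (sym (x-0#≈x 1#))
    ∏T-powers-δ (suc k) with ℕ.<-cmp k e
    ... | tri< k<e _ _ = begin
      P (suc k)             ≈⟨ P≈0 (s≤s z≤n) (s≤s k<e) ⟩
      0#                    ≈⟨ x-0#≈x 0# ⟨
      0# - 0#               ≈⟨ +-congˡ (-‿cong (shift-δ-< k<e)) ⟨
      0# - shift e δ k      ∎
    ... | tri≈ _ ≡.refl _ = begin
      P (suc e)             ≈⟨ P-suc e ⟩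
      u (suc e) - u e       ≈⟨ +-cong (Supp-powers e ℕ.≤-refl) (-‿cong (trans (u≈1 ℕ.≤-refl) (sym (shift-δ-≡ e)))) ⟩
      0# - shift e δ e      ∎
    ... | tri> _ _ e<k = begin
      P (suc k)             ≈⟨ Supp-powers (suc e) (s≤s e<k) ⟩
      0#                    ≈⟨ x-0#≈x 0# ⟨
      0# - 0#               ≈⟨ +-congˡ (-‿cong (shift-δ-> e<k)) ⟨
      0# - shift e δ k      ∎

    ∏T-powers : ∀ s → ∏T (powers η (suc e)) s ≋ (λ k → s k - shift (suc e) s k)
    ∏T-powers = ∏T-via-δ (powers η (suc e)) (suc e) ∏T-powers-δ

-- Evaluation, division by linear factors and uniqueness of interpolation

module Evaluation {c ℓ} (K : CommutativeRing c ℓ) where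
  open CommutativeRing K hiding (zero)
  open PowerSeries K
  open CommutativeSemiringExp commutativeSemiring using (_^_; ^-distrib-*; ^-congˡ; ^-homo-*)
  open SemiringSum semiring using (sum; sum-cong-≋; *-distribˡ-sum; sum-replicate-zero)
  open IntegerCoefficients K using (module Solver)
  open Solver using (solve; _:=_; _:+_; _:*_; _:-_; :-_; con)
  open SetoidReasoning setoid

  1^k≈1 : ∀ k → 1# ^ k ≈ 1#
  1^k≈1 zero    = refl
  1^k≈1 (suc k) = trans (*-identityˡ _) (1^k≈1 k)

  eval-neg : ∀ N s x → eval N (λ k → - s k) x ≈ - eval N s x
  eval-neg zero    s x = solve 0 (con ℤ.0ℤ := :- con ℤ.0ℤ) refl
  eval-neg (suc N) s x = trans (+-congʳ (eval-neg N s x))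
    (solve 3 (λ E s y → :- E :+ :- s :* y := :- (E :+ s :* y)) refl _ _ _)

  eval-+ : ∀ m N s x → eval (m ℕ.+ N) s x ≈ eval N s x + x ^ N * eval m (λ k → s (k ℕ.+ N)) x
  eval-+ zero    N s x = sym (trans (+-congˡ (zeroʳ _)) (+-identityʳ _))
  eval-+ (suc m) N s x = begin
    eval (m ℕ.+ N) s x + s (m ℕ.+ N) * x ^ (m ℕ.+ N)
      ≈⟨ +-cong (eval-+ m N s x) (*-congˡ (^-homo-* x m N)) ⟩
    (eval N s x + x ^ N * eval m _ x) + s (m ℕ.+ N) * (x ^ m * x ^ N)
      ≈⟨ solve 5 (λ E y F s z → (E :+ y :* F) :+ s :* (z :* y) := E :+ y :* (F :+ s :* z)) refl _ _ _ _ _ ⟩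
    eval N s x + x ^ N * (eval m _ x + s (m ℕ.+ N) * x ^ m)
      ∎

  eval-suc : ∀ m s x → eval (suc m) s x ≈ s 0 + x * eval m (s ∘ suc) x
  eval-suc zero    s x = solve 2 (λ s x → con ℤ.0ℤ :+ s :* con ℤ.1ℤ := s :+ x :* con ℤ.0ℤ) refl (s 0) x
  eval-suc (suc m) s x = trans (+-congʳ (eval-suc m s x))
    (solve 5 (λ s₀ x E s y → (s₀ :+ x :* E) :+ s :* (x :* y) := s₀ :+ x :* (E :+ s :* y)) refl _ _ _ _ _)

  eval≈sum : ∀ m s x → eval m s x ≈ sum {m} (λ a → s (toℕ a) * x ^ toℕ a)
  eval≈sum zero    s x = refl
  eval≈sum (suc m) s x = begin
    eval (suc m) s x                                    ≈⟨ eval-suc m s x ⟩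
    s 0 + x * eval m (s ∘ suc) x                        ≈⟨ +-cong (sym (*-identityʳ _)) (*-congˡ (eval≈sum m (s ∘ suc) x)) ⟩
    s 0 * 1# + x * sum {m} (λ a → s (suc (toℕ a)) * x ^ toℕ a)
      ≈⟨ +-congˡ (*-distribˡ-sum {m} x _) ⟩
    s 0 * 1# + sum {m} (λ a → x * (s (suc (toℕ a)) * x ^ toℕ a))
      ≈⟨ +-congˡ (sum-cong-≋ {m} (λ a → solve 3 (λ x s y → x :* (s :* y) := s :* (x :* y)) refl x (s (suc (toℕ a))) (x ^ toℕ a))) ⟩
    s 0 * 1# + sum {m} (λ a → s (suc (toℕ a)) * (x * x ^ toℕ a))
      ∎

  eval-Supp : ∀ {N s} x r → Supp N s → eval (r ℕ.+ N) s x ≈ eval N s x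
  eval-Supp x zero    supp = refl
  eval-Supp {N} {s} x (suc r) supp = begin
    eval (r ℕ.+ N) s x + s (r ℕ.+ N) * _  ≈⟨ +-congˡ (trans (*-congʳ (supp (ℕ.m≤n+m N r))) (zeroˡ _)) ⟩
    eval (r ℕ.+ N) s x + 0#               ≈⟨ +-identityʳ _ ⟩
    eval (r ℕ.+ N) s x                    ≈⟨ eval-Supp x r supp ⟩
    eval N s x                            ∎

  eval-δ : ∀ N x → eval (suc N) δ x ≈ 1#
  eval-δ N x = begin
    eval (suc N) δ x       ≈⟨ eval-suc N δ x ⟩
    1# + x * eval N 𝟘 x    ≈⟨ +-congˡ (trans (*-congˡ (eval-𝟘 N x)) (zeroʳ x)) ⟩
    1# + 0#                ≈⟨ +-identityʳ 1# ⟩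
    1#                     ∎

  -- The coefficient of degree k in s / (1 - a x) is the sum of aᵏ⁻ʲ sⱼ over j ≤ k, and aᵏ⁻ʲ = aᵏ
  -- xʲ. This is the factor theorem in disguise: if x is a root of a polynomial s, the quotient has
  -- no coefficients beyond the expected degree.
  T⁻¹≈eval : ∀ {a x} → a * x ≈ 1# → ∀ s k → T⁻¹ a s k ≈ a ^ k * eval (suc k) s x
  T⁻¹≈eval {a} {x} ax≈1 s zero    =
    solve 1 (λ s → s := con ℤ.1ℤ :* (con ℤ.0ℤ :+ s :* con ℤ.1ℤ)) refl (s 0)
  T⁻¹≈eval {a} {x} ax≈1 s (suc k) = begin
    s (suc k) + a * T⁻¹ a s k
      ≈⟨ +-cong (sym (*-identityʳ _)) (*-congˡ (T⁻¹≈eval ax≈1 s k)) ⟩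
    s (suc k) * 1# + a * (a ^ k * eval (suc k) s x)
      ≈⟨ +-congʳ (*-congˡ (trans (sym (1^k≈1 (suc k))) (trans (^-congˡ (suc k) (sym ax≈1)) (^-distrib-* a x (suc k))))) ⟩
    s (suc k) * (a ^ suc k * x ^ suc k) + a * (a ^ k * eval (suc k) s x)
      ≈⟨ solve 5 (λ s a b y E → s :* (a :* b :* y) :+ a :* (b :* E) := a :* b :* (E :+ s :* y)) refl
           (s (suc k)) a (a ^ k) (x ^ suc k) (eval (suc k) s x) ⟩
    a ^ suc k * (eval (suc k) s x + s (suc k) * x ^ suc k)
      ∎

  extend : ∀ {m} → (Fin m → Carrier) → Series
  extend {zero}  v k       = 0#
  extend {suc m} v zero    = v Fin.zero
  extend {suc m} v (suc k) = extend (v ∘ Fin.suc) k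

  extend-toℕ : ∀ {m} (v : Fin m → Carrier) a → extend v (toℕ a) ≈ v a
  extend-toℕ v Fin.zero    = refl
  extend-toℕ v (Fin.suc a) = extend-toℕ (v ∘ Fin.suc) a

  Supp-extend : ∀ {m} (v : Fin m → Carrier) → Supp m (extend v)
  Supp-extend {zero}  v _         = refl
  Supp-extend {suc m} v (s≤s m≤k) = Supp-extend (v ∘ Fin.suc) m≤k

  module _ (noZeroDivisors : ∀ {x y} → x * y ≈ 0# → x ≈ 0# ⊎ y ≈ 0#) where

    x-y≈0⇒x≈y : ∀ {x y} → x - y ≈ 0# → x ≈ y
    x-y≈0⇒x≈y {x} {y} x-y≈0 = begin
      x            ≈⟨ solve 2 (λ x y → x := (x :- y) :+ y) refl x y ⟩
      (x - y) + y  ≈⟨ +-congʳ x-y≈0 ⟩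
      0# + y       ≈⟨ +-identityˡ y ⟩
      y            ∎

    -- Dividing by the factor that vanishes at the first point lowers the degree bound by one and
    -- keeps the other roots, because that factor vanishes at no other point. The points come with
    -- inverses since the factors have the form 1 - a x.
    eval≈0⇒≋𝟘 : ∀ {m} (x x⁻¹ : Fin m → Carrier) → (∀ i → x⁻¹ i * x i ≈ 1#) →
                (∀ {i j} → x i ≈ x j → i ≡ j) → ∀ {s} → Supp m s →
                (∀ i → eval m s (x i) ≈ 0#) → s ≋ 𝟘
    eval≈0⇒≋𝟘 {zero}  x x⁻¹ inverse distinct supp roots k = supp z≤n
    eval≈0⇒≋𝟘 {suc m} x x⁻¹ inverse distinct {s} supp roots =
      ≋-trans (≋-sym (T-T⁻¹ a s)) (≋-trans (T-congʳ a u≋𝟘) (T-𝟘 a))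
      where
      a = x⁻¹ Fin.zero
      u = T⁻¹ a s

      supp-u : Supp m u
      supp-u {k} m≤k = begin
        T⁻¹ a s k                              ≈⟨ T⁻¹≈eval (inverse Fin.zero) s k ⟩
        a ^ k * eval (suc k) s (x Fin.zero)    ≡⟨ ≡.cong (λ j → a ^ k * eval j s (x Fin.zero))
                                                   (≡.trans (≡.cong suc (≡.sym (ℕ.m∸n+n≡m m≤k))) (≡.sym (ℕ.+-suc (k ℕ.∸ m) m))) ⟩
        a ^ k * eval (k ℕ.∸ m ℕ.+ suc m) s (x Fin.zero)
          ≈⟨ *-congˡ (trans (eval-Supp (x Fin.zero) (k ℕ.∸ m) supp) (roots Fin.zero)) ⟩
        a ^ k * 0#                             ≈⟨ zeroʳ _ ⟩
        0#                                     ∎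

      roots-u : ∀ i → eval m u (x (Fin.suc i)) ≈ 0#
      roots-u i with noZeroDivisors {1# - a * x (Fin.suc i)} (begin
        (1# - a * x (Fin.suc i)) * eval m u (x (Fin.suc i))  ≈⟨ eval-T-Supp a u (x (Fin.suc i)) supp-u ⟨
        eval (suc m) (T a u) (x (Fin.suc i))                 ≈⟨ eval-cong (suc m) _ (λ {k} _ → T-T⁻¹ a s k) ⟩
        eval (suc m) s (x (Fin.suc i))                       ≈⟨ roots (Fin.suc i) ⟩
        0#                                                   ∎)
      ... | inj₂ u≈0     = u≈0
      ... | inj₁ 1-ax≈0  = contradiction (distinct {Fin.zero} {Fin.suc i} (begin
        x Fin.zero                              ≈⟨ *-identityʳ _ ⟨
        x Fin.zero * 1#                         ≈⟨ *-congˡ (x-y≈0⇒x≈y 1-ax≈0) ⟩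
        x Fin.zero * (a * x (Fin.suc i))        ≈⟨ solve 3 (λ x a y → x :* (a :* y) := a :* x :* y) refl _ _ _ ⟩
        a * x Fin.zero * x (Fin.suc i)          ≈⟨ *-congʳ (inverse Fin.zero) ⟩
        1# * x (Fin.suc i)                      ≈⟨ *-identityˡ _ ⟩
        x (Fin.suc i)                           ∎)) λ ()

      u≋𝟘 : u ≋ 𝟘
      u≋𝟘 = eval≈0⇒≋𝟘 (x ∘ Fin.suc) (x⁻¹ ∘ Fin.suc) (inverse ∘ Fin.suc)
              (λ eq → Fin.suc-injective (distinct eq)) supp-u roots-u

    ∏T-root : ∀ as {x} → eval (length as ℕ.+ 1) (∏T as δ) x ≈ 0# → ¬ (1# ≈ 0#) → Any (λ a → a * x ≈ 1#) as
    ∏T-root []       {x} eq 1≉0 = contradiction (trans (sym (eval-δ 0 x)) eq) 1≉0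
    ∏T-root (a ∷ as) {x} eq 1≉0 with noZeroDivisors {1# - a * x}
      (trans (sym (eval-T-Supp a (∏T as δ) x (Supp-∏T as Supp-δ))) eq)
    ... | inj₁ 1-ax≈0 = here (sym (x-y≈0⇒x≈y 1-ax≈0))
    ... | inj₂ eq′    = there (∏T-root as eq′ 1≉0)

    -- The orthogonality relation that isolates one root in the average over K; the sum times z - 1
    -- telescopes. Exponents start at 1, as the truncation degrees do.
    geometric-sum : ∀ {n z} → z ^ n ≈ 1# → ¬ (z ≈ 1#) → sum {n} (λ k → z ^ suc (toℕ k)) ≈ 0#
    geometric-sum {n} {z} z^n≈1 z≉1 with noZeroDivisors {z - 1#} {sum {n} (λ k → z ^ suc (toℕ k))} (begin
      (z - 1#) * sum {n} (λ k → z ^ suc (toℕ k))           ≈⟨ *-congˡ (*-distribˡ-sum {n} z _) ⟨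
      (z - 1#) * (z * sum {n} (λ k → z ^ toℕ k))           ≈⟨ *-congˡ (*-congˡ (sum-cong-≋ {n} (λ k → *-identityˡ _))) ⟨
      (z - 1#) * (z * sum {n} (λ k → 1# * z ^ toℕ k))      ≈⟨ *-congˡ (*-congˡ (eval≈sum n (λ _ → 1#) z)) ⟨
      (z - 1#) * (z * eval n (λ _ → 1#) z)                 ≈⟨ solve 2 (λ z E → (z :- con ℤ.1ℤ) :* (z :* E) := z :* ((z :- con ℤ.1ℤ) :* E)) refl _ _ ⟩
      z * ((z - 1#) * eval n (λ _ → 1#) z)                 ≈⟨ *-congˡ (telescope n) ⟩
      z * (z ^ n - 1#)                                     ≈⟨ *-congˡ (trans (+-congʳ z^n≈1) (-‿inverseʳ 1#)) ⟩
      z * 0#                                               ≈⟨ zeroʳ z ⟩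
      0#                                                   ∎)
      where
      telescope : ∀ n → (z - 1#) * eval n (λ _ → 1#) z ≈ z ^ n - 1#
      telescope zero    = trans (zeroʳ _) (sym (-‿inverseʳ 1#))
      telescope (suc n) = begin
        (z - 1#) * (eval n (λ _ → 1#) z + 1# * z ^ n)
          ≈⟨ solve 3 (λ z E y → (z :- con ℤ.1ℤ) :* (E :+ con ℤ.1ℤ :* y) := (z :- con ℤ.1ℤ) :* E :+ (z :* y :- y)) refl _ _ _ ⟩
        (z - 1#) * eval n (λ _ → 1#) z + (z * z ^ n - z ^ n)
          ≈⟨ +-congʳ (telescope n) ⟩
        (z ^ n - 1#) + (z * z ^ n - z ^ n)
          ≈⟨ solve 2 (λ x y → (x :- con ℤ.1ℤ) :+ (y :- x) := y :- con ℤ.1ℤ) refl _ _ ⟩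
        z ^ suc n - 1#
          ∎
    ... | inj₁ z-1≈0 = contradiction (x-y≈0⇒x≈y z-1≈0) z≉1
    ... | inj₂ sum≈0 = sum≈0

  -- Over the complex numbers this is definitionally the identity matrix `1ᴹ`.
  indicator : ∀ {m} → Fin m → Fin m → Carrier
  indicator i j = if does (i Fin.≟ j) then 1# else 0#

  sum-indicatorˡ : ∀ {m} i (f : Fin m → Carrier) → sum (λ k → indicator i k * f k) ≈ f i
  sum-indicatorˡ {suc m} Fin.zero    f = begin
    1# * f Fin.zero + sum (λ k → 0# * f (Fin.suc k))
      ≈⟨ +-cong (*-identityˡ _) (trans (sum-cong-≋ {m} (λ k → zeroˡ _)) (sum-replicate-zero m)) ⟩
    f Fin.zero + 0#       ≈⟨ +-identityʳ _ ⟩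
    f Fin.zero            ∎
  sum-indicatorˡ {suc m} (Fin.suc i) f =
    trans (+-cong (zeroˡ _) (sum-indicatorˡ i (f ∘ Fin.suc))) (+-identityˡ _)

  indicator-sym : ∀ {m} (i j : Fin m) → indicator i j ≈ indicator j i
  indicator-sym Fin.zero    Fin.zero    = refl
  indicator-sym Fin.zero    (Fin.suc j) = refl
  indicator-sym (Fin.suc i) Fin.zero    = refl
  indicator-sym (Fin.suc i) (Fin.suc j) = indicator-sym i j

-- Arithmetic of the real field and bounds on absolute values

module OrderedField {ℓ} (R : CompleteOrderedField ℓ) where
  open CompleteOrderedField R public
    hiding (zero) renaming (Carrier to ℝ)
  open RingProperties ring public using (-0#≈0#)
  open AbelianGroupProperties +-abelianGroup public
    using () renaming (⁻¹-involutive to -‿involutive)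
  open SemiringExp semiring public using (_^_; ^-assocʳ)
  open SemiringMult semiring using (×-homo-+; ×1-homo-*)
  open Cyclotomic R public using (fromℕ)
  open IntegerCoefficients commutativeRing public using (module Solver)
  open Solver using (solve; _:=_; _:+_; _:*_; _:-_; :-_; con)

  strictTotalOrder : StrictTotalOrder ℓ ℓ ℓ
  strictTotalOrder = record { isStrictTotalOrder = isStrictTotalOrder }

  open StrictTotalOrder strictTotalOrder public using (strictPartialOrder; <-respˡ-≈; <-respʳ-≈)
    renaming (trans to <-trans; irrefl to <-irrefl; _≟_ to _≈?_)
  open StrictTotalOrderProperties strictTotalOrder using (decTotalOrder)
  open DecTotalOrder decTotalOrder public using (≤-respˡ-≈; ≤-respʳ-≈)
    renaming (refl to ≤-refl; trans to ≤-trans; reflexive to ≤-reflexive)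

  module ≤-Reasoning = StrictReasoning strictPartialOrder
  open ≤-Reasoning

  ≮⇒≥ : ∀ {x y} → ¬ (x < y) → y ≤ x
  ≮⇒≥ {x} {y} x≮y with compare x y
  ... | tri< x<y _ _ = contradiction x<y x≮y
  ... | tri≈ _ x≈y _ = inj₂ (sym x≈y)
  ... | tri> _ _ y<x = inj₁ y<x

  ≤⇒≯ : ∀ {x y} → x ≤ y → ¬ (y < x)
  ≤⇒≯ (inj₁ x<y) y<x = <-irrefl refl (<-trans x<y y<x)
  ≤⇒≯ (inj₂ x≈y) y<x = <-irrefl (sym x≈y) y<x

  <-≤-trans : ∀ {x y z} → x < y → y ≤ z → x < z
  <-≤-trans {x} {y} {z} x<y y≤z = begin-strict x <⟨ x<y ⟩ y ≤⟨ y≤z ⟩ z ∎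

  +-monoˡ-≤ : ∀ z {x y} → x ≤ y → x + z ≤ y + z
  +-monoˡ-≤ z (inj₁ x<y) = inj₁ (+-monoˡ-< z x<y)
  +-monoˡ-≤ z (inj₂ x≈y) = inj₂ (+-congʳ x≈y)

  +-monoʳ-≤ : ∀ z {x y} → x ≤ y → z + x ≤ z + y
  +-monoʳ-≤ z {x} {y} x≤y = begin
    z + x  ≈⟨ +-comm z x ⟩
    x + z  ≤⟨ +-monoˡ-≤ z x≤y ⟩
    y + z  ≈⟨ +-comm y z ⟩
    z + y  ∎

  +-mono-≤ : ∀ {x y u v} → x ≤ y → u ≤ v → x + u ≤ y + v
  +-mono-≤ {x} {y} {u} {v} x≤y u≤v = ≤-trans (+-monoˡ-≤ u x≤y) (+-monoʳ-≤ y u≤v)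

  +-mono-< : ∀ {x y u v} → x < y → u < v → x + u < y + v
  +-mono-< {x} {y} {u} {v} x<y u<v = begin-strict
    x + u  <⟨ +-monoˡ-< u x<y ⟩
    y + u  ≈⟨ +-comm y u ⟩
    u + y  <⟨ +-monoˡ-< y u<v ⟩
    v + y  ≈⟨ +-comm v y ⟩
    y + v  ∎

  x≤y⇒0≤y-x : ∀ {x y} → x ≤ y → 0# ≤ y - x
  x≤y⇒0≤y-x {x} {y} x≤y = begin
    0#     ≈⟨ -‿inverseʳ x ⟨
    x - x  ≤⟨ +-monoˡ-≤ (- x) x≤y ⟩
    y - x  ∎

  0≤y-x⇒x≤y : ∀ {x y} → 0# ≤ y - x → x ≤ y
  0≤y-x⇒x≤y {x} {y} 0≤y-x = begin
    x            ≈⟨ +-identityˡ x ⟨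
    0# + x       ≤⟨ +-monoˡ-≤ x 0≤y-x ⟩
    (y - x) + x  ≈⟨ solve 2 (λ x y → (y :- x) :+ x := y) refl x y ⟩
    y            ∎

  neg-antimono-≤ : ∀ {x y} → x ≤ y → - y ≤ - x
  neg-antimono-≤ {x} {y} x≤y = 0≤y-x⇒x≤y (begin
    0#          ≤⟨ x≤y⇒0≤y-x x≤y ⟩
    y - x       ≈⟨ solve 2 (λ x y → y :- x := :- x :- (:- y)) refl x y ⟩
    - x - (- y) ∎)

  x<y⇒0<y-x : ∀ {x y} → x < y → 0# < y - x
  x<y⇒0<y-x {x} {y} x<y = begin-strict
    0#     ≈⟨ -‿inverseʳ x ⟨
    x - x  <⟨ +-monoˡ-< (- x) x<y ⟩
    y - x  ∎

  0<y-x⇒x<y : ∀ {x y} → 0# < y - x → x < y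
  0<y-x⇒x<y {x} {y} 0<y-x = begin-strict
    x            ≈⟨ +-identityˡ x ⟨
    0# + x       <⟨ +-monoˡ-< x 0<y-x ⟩
    (y - x) + x  ≈⟨ solve 2 (λ x y → (y :- x) :+ x := y) refl x y ⟩
    y            ∎

  *-nonneg : ∀ {x y} → 0# ≤ x → 0# ≤ y → 0# ≤ x * y
  *-nonneg (inj₁ 0<x) (inj₁ 0<y) = inj₁ (*-positive 0<x 0<y)
  *-nonneg (inj₂ 0≈x) _          = inj₂ (sym (trans (*-congʳ (sym 0≈x)) (zeroˡ _)))
  *-nonneg (inj₁ _)   (inj₂ 0≈y) = inj₂ (sym (trans (*-congˡ (sym 0≈y)) (zeroʳ _)))

  *-monoˡ-≤ : ∀ {z x y} → 0# ≤ z → x ≤ y → x * z ≤ y * z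
  *-monoˡ-≤ {z} {x} {y} 0≤z x≤y = 0≤y-x⇒x≤y (begin
    0#             ≤⟨ *-nonneg (x≤y⇒0≤y-x x≤y) 0≤z ⟩
    (y - x) * z    ≈⟨ solve 3 (λ x y z → (y :- x) :* z := y :* z :- x :* z) refl x y z ⟩
    y * z - x * z  ∎)

  *-mono-≤ : ∀ {x y u v} → 0# ≤ u → 0# ≤ y → x ≤ y → u ≤ v → x * u ≤ y * v
  *-mono-≤ {x} {y} {u} {v} 0≤u 0≤y x≤y u≤v = begin
    x * u  ≤⟨ *-monoˡ-≤ 0≤u x≤y ⟩
    y * u  ≈⟨ *-comm y u ⟩
    u * y  ≤⟨ *-monoˡ-≤ 0≤y u≤v ⟩
    v * y  ≈⟨ *-comm v y ⟩
    y * v  ∎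

  *-monoˡ-< : ∀ {z x y} → 0# < z → x < y → x * z < y * z
  *-monoˡ-< {z} {x} {y} 0<z x<y = 0<y-x⇒x<y (begin-strict
    0#             <⟨ *-positive (x<y⇒0<y-x x<y) 0<z ⟩
    (y - x) * z    ≈⟨ solve 3 (λ x y z → (y :- x) :* z := y :* z :- x :* z) refl x y z ⟩
    y * z - x * z  ∎)

  *-mono-< : ∀ {x y u v} → 0# ≤ x → 0# ≤ u → x < y → u < v → x * u < y * v
  *-mono-< {x} {y} {u} {v} 0≤x 0≤u x<y u<v = begin-strict
    x * u  ≤⟨ *-monoˡ-≤ 0≤u (inj₁ x<y) ⟩
    y * u  ≈⟨ *-comm y u ⟩
    u * y  <⟨ *-monoˡ-< (≤-<-trans 0≤x x<y) u<v ⟩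
    v * y  ≈⟨ *-comm v y ⟩
    y * v  ∎
    where
    ≤-<-trans : ∀ {x y z} → x ≤ y → y < z → x < z
    ≤-<-trans {x} {y} {z} x≤y y<z = begin-strict x ≤⟨ x≤y ⟩ y <⟨ y<z ⟩ z ∎

  x<0⇒0<-x : ∀ {x} → x < 0# → 0# < - x
  x<0⇒0<-x {x} x<0 = begin-strict
    0#      <⟨ x<y⇒0<y-x x<0 ⟩
    0# - x  ≈⟨ +-identityˡ _ ⟩
    - x     ∎

  x≉0⇒0<x*x : ∀ {x} → ¬ (x ≈ 0#) → 0# < x * x
  x≉0⇒0<x*x {x} x≉0 with compare x 0#
  ... | tri≈ _ x≈0 _ = contradiction x≈0 x≉0
  ... | tri> _ _ 0<x = *-positive 0<x 0<x
  ... | tri< x<0 _ _ = begin-strict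
    0#         <⟨ *-positive (x<0⇒0<-x x<0) (x<0⇒0<-x x<0) ⟩
    - x * - x  ≈⟨ solve 1 (λ x → :- x :* :- x := x :* x) refl x ⟩
    x * x      ∎

  0≤x*x : ∀ x → 0# ≤ x * x
  0≤x*x x with x ≈? 0#
  ... | no  x≉0 = inj₁ (x≉0⇒0<x*x x≉0)
  ... | yes x≈0 = inj₂ (sym (trans (*-congʳ x≈0) (zeroˡ x)))

  0<1 : 0# < 1#
  0<1 = <-respʳ-≈ (*-identityˡ 1#) (x≉0⇒0<x*x (0≉1 ∘ sym))

  x*y≈0⇒x≈0∨y≈0 : ∀ {x y} → x * y ≈ 0# → x ≈ 0# ⊎ y ≈ 0#
  x*y≈0⇒x≈0∨y≈0 {x} {y} xy≈0 with x ≈? 0#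
  ... | yes x≈0 = inj₁ x≈0
  ... | no  x≉0 = inj₂ (begin-equality
    y                 ≈⟨ *-identityˡ y ⟨
    1# * y            ≈⟨ *-congʳ (⁻¹-inverse x x≉0) ⟨
    (x * x ⁻¹) * y    ≈⟨ solve 3 (λ x i y → (x :* i) :* y := i :* (x :* y)) refl x (x ⁻¹) y ⟩
    x ⁻¹ * (x * y)    ≈⟨ *-congˡ xy≈0 ⟩
    x ⁻¹ * 0#         ≈⟨ zeroʳ _ ⟩
    0#                ∎)

  x*x≤y*y⇒x≤y : ∀ {x y} → 0# ≤ y → x * x ≤ y * y → x ≤ y
  x*x≤y*y⇒x≤y 0≤y xx≤yy = ≮⇒≥ (λ y<x → ≤⇒≯ xx≤yy (*-mono-< 0≤y 0≤y y<x y<x))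

  0≤x+x⇒0≤x : ∀ {x} → 0# ≤ x + x → 0# ≤ x
  0≤x+x⇒0≤x {x} 0≤x+x = ≮⇒≥ λ x<0 →
    ≤⇒≯ 0≤x+x (<-respʳ-≈ (+-identityˡ 0#) (+-mono-< x<0 x<0))

  fromℕ-+ : ∀ m n → fromℕ (m ℕ.+ n) ≈ fromℕ m + fromℕ n
  fromℕ-+ = ×-homo-+ 1#

  fromℕ-* : ∀ m n → fromℕ (m ℕ.* n) ≈ fromℕ m * fromℕ n
  fromℕ-* = ×1-homo-*

  fromℕ-1 : fromℕ 1 ≈ 1#
  fromℕ-1 = +-identityʳ 1#

  fromℕ-^ : ∀ m k → fromℕ (m ℕ.^ k) ≈ fromℕ m ^ k
  fromℕ-^ m zero    = fromℕ-1
  fromℕ-^ m (suc k) = trans (fromℕ-* m (m ℕ.^ k)) (*-congˡ (fromℕ-^ m k))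

  0≤fromℕ : ∀ n → 0# ≤ fromℕ n
  0≤fromℕ zero    = ≤-refl
  0≤fromℕ (suc n) = begin
    0#            ≈⟨ +-identityˡ 0# ⟨
    0# + 0#       ≤⟨ +-mono-≤ (inj₁ 0<1) (0≤fromℕ n) ⟩
    1# + fromℕ n  ∎

  fromℕ-mono-≤ : ∀ {m n} → m ℕ.≤ n → fromℕ m ≤ fromℕ n
  fromℕ-mono-≤ {n = n} z≤n       = 0≤fromℕ n
  fromℕ-mono-≤         (s≤s m≤n) = +-monoʳ-≤ 1# (fromℕ-mono-≤ m≤n)

  fromℕ-suc-< : ∀ n → fromℕ n < fromℕ (suc n)
  fromℕ-suc-< n = <-respˡ-≈ (+-identityˡ _) (+-monoˡ-< (fromℕ n) 0<1)

  fromℕ-mono-< : ∀ {m n} → m ℕ.< n → fromℕ m < fromℕ n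
  fromℕ-mono-< {m} m<n = <-≤-trans (fromℕ-suc-< m) (fromℕ-mono-≤ m<n)

  fromℕ-cancel-≤ : ∀ {m n} → fromℕ m ≤ fromℕ n → m ℕ.≤ n
  fromℕ-cancel-≤ m≤n = ℕ.≮⇒≥ (λ n<m → ≤⇒≯ m≤n (fromℕ-mono-< n<m))

  0≤x^k : ∀ {x} k → 0# ≤ x → 0# ≤ x ^ k
  0≤x^k zero    0≤x = inj₁ 0<1
  0≤x^k (suc k) 0≤x = *-nonneg 0≤x (0≤x^k k 0≤x)

  1≤x^k : ∀ {x} k → 1# ≤ x → 1# ≤ x ^ k
  1≤x^k     zero    1≤x = ≤-refl
  1≤x^k {x} (suc k) 1≤x = begin
    1#         ≈⟨ *-identityˡ 1# ⟨
    1# * 1#    ≤⟨ *-mono-≤ (inj₁ 0<1) (≤-trans (inj₁ 0<1) 1≤x) 1≤x (1≤x^k k 1≤x) ⟩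
    x * x ^ k  ∎

  ^-monoʳ-≤ : ∀ {x j k} → 1# ≤ x → j ℕ.≤ k → x ^ j ≤ x ^ k
  ^-monoʳ-≤ {k = k} 1≤x z≤n       = 1≤x^k k 1≤x
  ^-monoʳ-≤ {x} {suc j} {suc k} 1≤x (s≤s j≤k) =
    *-mono-≤ (0≤x^k j 0≤x) 0≤x ≤-refl (^-monoʳ-≤ 1≤x j≤k)
    where 0≤x = ≤-trans (inj₁ 0<1) 1≤x

  ^-monoˡ-≤ : ∀ {x y} k → 0# ≤ x → x ≤ y → x ^ k ≤ y ^ k
  ^-monoˡ-≤ zero    0≤x x≤y = ≤-refl
  ^-monoˡ-≤ (suc k) 0≤x x≤y = *-mono-≤ (0≤x^k k 0≤x) (≤-trans 0≤x x≤y) x≤y (^-monoˡ-≤ k 0≤x x≤y)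

  ^-monoˡ-< : ∀ {x y} k → 0# ≤ x → x < y → x ^ suc k < y ^ suc k
  ^-monoˡ-< {x} {y} zero    0≤x x<y = *-monoˡ-< 0<1 x<y
  ^-monoˡ-< {x} {y} (suc k) 0≤x x<y = *-mono-< 0≤x (0≤x^k (suc k) 0≤x) x<y (^-monoˡ-< k 0≤x x<y)

  infix 4 ∣_∣≤_

  -- A bound on the absolute value as a pair of inequalities, so that neither a sign distinction nor
  -- a square root enters.
  ∣_∣≤_ : ℝ → ℝ → Set ℓ
  ∣ x ∣≤ b = (- b ≤ x) × (x ≤ b)

  ∣∣≤-cong : ∀ {x y b} → x ≈ y → ∣ x ∣≤ b → ∣ y ∣≤ b
  ∣∣≤-cong x≈y (l , u) = ≤-respʳ-≈ x≈y l , ≤-respˡ-≈ x≈y u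

  ∣∣≤-mono : ∀ {x a b} → a ≤ b → ∣ x ∣≤ a → ∣ x ∣≤ b
  ∣∣≤-mono a≤b (l , u) = ≤-trans (neg-antimono-≤ a≤b) l , ≤-trans u a≤b

  ∣0∣≤ : ∀ {b} → 0# ≤ b → ∣ 0# ∣≤ b
  ∣0∣≤ 0≤b = ≤-respʳ-≈ -0#≈0# (neg-antimono-≤ 0≤b) , 0≤b

  ∣-∣≤ : ∀ {x b} → ∣ x ∣≤ b → ∣ - x ∣≤ b
  ∣-∣≤ (l , u) = neg-antimono-≤ u , ≤-respʳ-≈ (-‿involutive _) (neg-antimono-≤ l)

  ∣+∣≤ : ∀ {x y a b} → ∣ x ∣≤ a → ∣ y ∣≤ b → ∣ x + y ∣≤ a + b
  ∣+∣≤ {x} {y} {a} {b} (l₁ , u₁) (l₂ , u₂) = ≤-respˡ-≈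
    (solve 2 (λ a b → :- a :+ :- b := :- (a :+ b)) refl a b) (+-mono-≤ l₁ l₂) , +-mono-≤ u₁ u₂

  private
    -- 2 (a b - x y) = (a - x)(b + y) + (a + x)(b - y)
    x*y≤a*b : ∀ {x y a b} → ∣ x ∣≤ a → ∣ y ∣≤ b → x * y ≤ a * b
    x*y≤a*b {x} {y} {a} {b} (l₁ , u₁) (l₂ , u₂) = 0≤y-x⇒x≤y (0≤x+x⇒0≤x (begin
      0#                                           ≈⟨ +-identityˡ 0# ⟨
      0# + 0#                                      ≤⟨ +-mono-≤
        (*-nonneg (x≤y⇒0≤y-x u₁) (x≤y⇒0≤y-x l₂)) (*-nonneg (x≤y⇒0≤y-x l₁) (x≤y⇒0≤y-x u₂)) ⟩
      (a - x) * (y - - b) + (x - - a) * (b - y)    ≈⟨ solve 4 (λ x y a b →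
        (a :- x) :* (y :- :- b) :+ (x :- :- a) :* (b :- y) :=
        (a :* b :- x :* y) :+ (a :* b :- x :* y)) refl x y a b ⟩
      (a * b - x * y) + (a * b - x * y)            ∎))

  ∣*∣≤ : ∀ {x y a b} → ∣ x ∣≤ a → ∣ y ∣≤ b → ∣ x * y ∣≤ a * b
  ∣*∣≤ {x} {y} {a} {b} p q = (begin
    - (a * b)      ≤⟨ neg-antimono-≤ (x*y≤a*b (∣-∣≤ p) q) ⟩
    - (- x * y)    ≈⟨ solve 2 (λ x y → :- (:- x :* y) := x :* y) refl x y ⟩
    x * y          ∎) , x*y≤a*b p q

  x*x≤y*y⇒∣x∣≤y : ∀ {x y} → 0# ≤ y → x * x ≤ y * y → ∣ x ∣≤ y
  x*x≤y*y⇒∣x∣≤y {x} {y} 0≤y xx≤yy =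
    ≤-respʳ-≈ (-‿involutive x) (neg-antimono-≤ (x*x≤y*y⇒x≤y 0≤y
      (≤-respˡ-≈ (solve 1 (λ x → x :* x := :- x :* :- x) refl x) xx≤yy))) ,
    x*x≤y*y⇒x≤y 0≤y xx≤yy

-- Square roots, real powers and complex numbers

module ComplexNumbers {ℓ} (R : CompleteOrderedField ℓ) where
  open OrderedField R
  open Cyclotomic R using (√_; _^ʳ_; ℂ; _+i_; re; im; ℂ-rawRing)
  open Solver using (solve; _:=_; _:+_; _:*_; _:-_; :-_; con)
  open ≤-Reasoning

  module _ {x b : ℝ} (0≤x : 0# ≤ x) (0≤b : 0# ≤ b) (x≤b*b : x ≤ b * b) where
    private
      b-upper : UpperBound (λ y → y * y ≤ x) b
      b-upper y*y≤x = x*x≤y*y⇒x≤y 0≤b (≤-trans y*y≤x x≤b*b)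

      0-member : 0# * 0# ≤ x
      0-member = ≤-respˡ-≈ (sym (zeroˡ 0#)) 0≤x

    -- A `sup` is specified only for nonempty sets that are bounded above: 0 is a member of the set
    -- defining `√ x`, and b bounds it.
    √-nonneg : 0# ≤ √ x
    √-nonneg = sup-upper (λ y → y * y ≤ x) (0# , 0-member) (b , b-upper) 0-member

    √-upper : √ x ≤ b
    √-upper = sup-least (λ y → y * y ≤ x) (0# , 0-member) b-upper

  -- If no natural number reached x, the natural numbers would have a least upper bound S; with n
  -- also n + 1 lies below S, so S - 1 would be a smaller upper bound. The argument refutes the
  -- absence of n without producing one, hence the double negation.
  archimedean : ∀ x → ¬ ¬ (∃[ n ] x ≤ fromℕ n)
  archimedean x no-bound = ≤⇒≯ S≤S-1 S-1<S
    where
    P : ℝ → Set ℓ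
    P y = ∃[ n ] y ≈ fromℕ n
    S : ℝ
    S = sup P
    below-x : UpperBound P x
    below-x (n , y≈n) = ≤-respˡ-≈ (sym y≈n) (inj₁ (≰⇒> (λ x≤n → no-bound (n , x≤n))))
      where
      ≰⇒> : ∀ {u v} → ¬ (u ≤ v) → v < u
      ≰⇒> {u} {v} u≰v with v <? u
      ... | yes v<u = v<u
      ... | no  v≮u = contradiction (≮⇒≥ v≮u) u≰v
    ≤S : UpperBound P S
    ≤S = sup-upper P (0# , 0 , refl) (x , below-x)
    below-S-1 : UpperBound P (S - 1#)
    below-S-1 {y} (n , y≈n) = begin
      y                     ≈⟨ y≈n ⟩
      fromℕ n               ≈⟨ solve 1 (λ n → n := (con ℤ.1ℤ :+ n) :- con ℤ.1ℤ) refl (fromℕ n) ⟩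
      fromℕ (suc n) - 1#    ≤⟨ +-monoˡ-≤ (- 1#) (≤S (suc n , refl)) ⟩
      S - 1#                ∎
    S≤S-1 : S ≤ S - 1#
    S≤S-1 = sup-least P (0# , 0 , refl) below-S-1
    S-1<S : S - 1# < S
    S-1<S = begin-strict
      S - 1#           ≈⟨ +-identityˡ _ ⟨
      0# + (S - 1#)    <⟨ +-monoˡ-< (S - 1#) 0<1 ⟩
      1# + (S - 1#)    ≈⟨ solve 1 (λ s → con ℤ.1ℤ :+ (s :- con ℤ.1ℤ) := s) refl S ⟩
      S                ∎

  -- The archimedean property only yields a bound of the exponent up to double negation,
  -- which is enough because ≤ is stable.
  ^≤^ʳ : ∀ {b c} E → 1# ≤ b → fromℕ E ≤ c → b ^ E ≤ b ^ʳ c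
  ^≤^ʳ {b} {c} E 1≤b E≤c = ≮⇒≥ λ sup<b^E → archimedean c λ (M , c≤M) →
    ≤⇒≯ (sup-upper P (b ^ E , member) (b ^ M , upper M c≤M) member) sup<b^E
    where
    0≤b : 0# ≤ b
    0≤b = ≤-trans (inj₁ 0<1) 1≤b
    P : ℝ → Set ℓ
    P y = ∃[ p ] ∃[ q ] (1 ℕ.≤ q) × (fromℕ p ≤ fromℕ q * c) × (0# ≤ y) × (y ^ q ≈ b ^ p)
    member : P (b ^ E)
    member = E , 1 , ℕ.≤-refl , ≤-respʳ-≈ (sym (trans (*-congʳ fromℕ-1) (*-identityˡ c))) E≤c ,
             0≤x^k E 0≤b , *-identityʳ (b ^ E)
    -- Supplies the boundedness that `sup-upper` asks for: p / q ≤ c ≤ M gives p ≤ M q, hence the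
    -- q-th power of y is at most that of `b ^ M`.
    upper : ∀ M → c ≤ fromℕ M → UpperBound P (b ^ M)
    upper M c≤M {y} (p , suc q , _ , p≤qc , 0≤y , y^q≈b^p) = ≮⇒≥ λ b^M<y →
      ≤⇒≯ y^q≤ (^-monoˡ-< q (0≤x^k M 0≤b) b^M<y)
      where
      p≤Mq : p ℕ.≤ M ℕ.* suc q
      p≤Mq = ≡.subst (p ℕ.≤_) (ℕ.*-comm (suc q) M) $ fromℕ-cancel-≤ (begin
        fromℕ p                     ≤⟨ p≤qc ⟩
        fromℕ (suc q) * c           ≤⟨ *-mono-≤ 0≤c (0≤fromℕ (suc q)) ≤-refl c≤M ⟩
        fromℕ (suc q) * fromℕ M     ≈⟨ fromℕ-* (suc q) M ⟨
        fromℕ (suc q ℕ.* M)         ∎)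
        where 0≤c = ≤-trans (0≤fromℕ E) E≤c
      y^q≤ : y ^ suc q ≤ (b ^ M) ^ suc q
      y^q≤ = begin
        y ^ suc q             ≈⟨ y^q≈b^p ⟩
        b ^ p                 ≤⟨ ^-monoʳ-≤ 1≤b p≤Mq ⟩
        b ^ (M ℕ.* suc q)     ≈⟨ ^-assocʳ b M (suc q) ⟨
        (b ^ M) ^ suc q       ∎

  ℂ-commutativeRing : CommutativeRing ℓ ℓ
  ℂ-commutativeRing = record
    { RawRing ℂ-rawRing
    ; isCommutativeRing = record
      { isRing = record
        { +-isAbelianGroup = record
          { isGroup = record
            { isMonoid = record
              { isSemigroup = record
                { isMagma = record
                  { isEquivalence = record
                    { refl  = refl , refl
                    ; sym   = λ (p , q) → sym p , sym q
                    ; trans = λ (p , q) (p′ , q′) → trans p p′ , trans q q′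
                    }
                  ; ∙-cong = λ (p , q) (p′ , q′) → +-cong p p′ , +-cong q q′
                  }
                ; assoc = λ x y z → +-assoc _ _ _ , +-assoc _ _ _
                }
              ; identity = (λ x → +-identityˡ _ , +-identityˡ _) , (λ x → +-identityʳ _ , +-identityʳ _)
              }
            ; inverse = (λ x → -‿inverseˡ _ , -‿inverseˡ _) , (λ x → -‿inverseʳ _ , -‿inverseʳ _)
            ; ⁻¹-cong = λ (p , q) → -‿cong p , -‿cong q
            }
          ; comm = λ x y → +-comm _ _ , +-comm _ _
          }
        ; *-cong = λ (p , q) (p′ , q′) →
            +-cong (*-cong p p′) (-‿cong (*-cong q q′)) , +-cong (*-cong p q′) (*-cong q p′)
        ; *-assoc = λ (a +i b) (c +i d) (e +i f) →
            solve 6 (λ a b c d e f →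
              (a :* c :- b :* d) :* e :- (a :* d :+ b :* c) :* f :=
              a :* (c :* e :- d :* f) :- b :* (c :* f :+ d :* e)) refl a b c d e f ,
            solve 6 (λ a b c d e f →
              (a :* c :- b :* d) :* f :+ (a :* d :+ b :* c) :* e :=
              a :* (c :* f :+ d :* e) :+ b :* (c :* e :- d :* f)) refl a b c d e f
        ; *-identity =
            (λ (a +i b) →
              solve 2 (λ a b → con ℤ.1ℤ :* a :- con ℤ.0ℤ :* b := a) refl a b ,
              solve 2 (λ a b → con ℤ.1ℤ :* b :+ con ℤ.0ℤ :* a := b) refl a b) ,
            (λ (a +i b) →
              solve 2 (λ a b → a :* con ℤ.1ℤ :- b :* con ℤ.0ℤ := a) refl a b ,
              solve 2 (λ a b → a :* con ℤ.0ℤ :+ b :* con ℤ.1ℤ := b) refl a b)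
        ; distrib =
            (λ (a +i b) (c +i d) (e +i f) →
              solve 6 (λ a b c d e f → a :* (c :+ e) :- b :* (d :+ f) :=
                (a :* c :- b :* d) :+ (a :* e :- b :* f)) refl a b c d e f ,
              solve 6 (λ a b c d e f → a :* (d :+ f) :+ b :* (c :+ e) :=
                (a :* d :+ b :* c) :+ (a :* f :+ b :* e)) refl a b c d e f) ,
            (λ (a +i b) (c +i d) (e +i f) →
              solve 6 (λ a b c d e f → (c :+ e) :* a :- (d :+ f) :* b :=
                (c :* a :- d :* b) :+ (e :* a :- f :* b)) refl a b c d e f ,
              solve 6 (λ a b c d e f → (c :+ e) :* b :+ (d :+ f) :* a :=
                (c :* b :+ d :* a) :+ (e :* b :+ f :* a)) refl a b c d e f)
        }
      ; *-comm = λ (a +i b) (c +i d) →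
          solve 4 (λ a b c d → a :* c :- b :* d := c :* a :- d :* b) refl a b c d ,
          solve 4 (λ a b c d → a :* d :+ b :* c := c :* b :+ d :* a) refl a b c d
      }
    }

  module ℂR = CommutativeRing ℂ-commutativeRing
  open SemiringExp ℂR.semiring using () renaming (_^_ to _^ᶜ_)

  -- The squared modulus is a polynomial in the coordinates, hence multiplicative by a ring
  -- identity; the square root in `∣_∣` is left to the norm estimates.
  normSq : ℂ → ℝ
  normSq z = re z * re z + im z * im z

  normSq-cong : ∀ {z w} → z ℂR.≈ w → normSq z ≈ normSq w
  normSq-cong (p , q) = +-cong (*-cong p p) (*-cong q q)

  normSq-* : ∀ z w → normSq (z ℂR.* w) ≈ normSq z * normSq w
  normSq-* (a +i b) (c +i d) = solve 4 (λ a b c d →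
    (a :* c :- b :* d) :* (a :* c :- b :* d) :+ (a :* d :+ b :* c) :* (a :* d :+ b :* c) :=
    (a :* a :+ b :* b) :* (c :* c :+ d :* d)) refl a b c d

  normSq-1 : normSq ℂR.1# ≈ 1#
  normSq-1 = solve 0 (con ℤ.1ℤ :* con ℤ.1ℤ :+ con ℤ.0ℤ :* con ℤ.0ℤ := con ℤ.1ℤ) refl

  normSq-^ : ∀ z k → normSq (z ^ᶜ k) ≈ normSq z ^ k
  normSq-^ z zero    = normSq-1
  normSq-^ z (suc k) = trans (normSq-* z (z ^ᶜ k)) (*-congˡ (normSq-^ z k))

  normSq-nonneg : ∀ z → 0# ≤ normSq z
  normSq-nonneg z = ≤-respˡ-≈ (+-identityˡ 0#) (+-mono-≤ (0≤x*x (re z)) (0≤x*x (im z)))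

  re*re≤normSq : ∀ z → re z * re z ≤ normSq z
  re*re≤normSq z = ≤-respˡ-≈ (+-identityʳ _) (+-monoʳ-≤ _ (0≤x*x (im z)))

  im*im≤normSq : ∀ z → im z * im z ≤ normSq z
  im*im≤normSq z = ≤-respˡ-≈ (+-identityˡ _) (+-monoˡ-≤ _ (0≤x*x (re z)))

  normSq≈0⇒≈0 : ∀ {z} → normSq z ≈ 0# → z ℂR.≈ ℂR.0#
  normSq≈0⇒≈0 {z} N≈0 = x*x≤0⇒x≈0 (≤-respʳ-≈ N≈0 (re*re≤normSq z)) ,
                        x*x≤0⇒x≈0 (≤-respʳ-≈ N≈0 (im*im≤normSq z))
    where
    x*x≤0⇒x≈0 : ∀ {x} → x * x ≤ 0# → x ≈ 0#
    x*x≤0⇒x≈0 {x} xx≤0 with x ≈? 0#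
    ... | yes x≈0 = x≈0
    ... | no  x≉0 = contradiction (x≉0⇒0<x*x x≉0) (≤⇒≯ xx≤0)

  ℂ-noZeroDivisors : ∀ {z w} → z ℂR.* w ℂR.≈ ℂR.0# → z ℂR.≈ ℂR.0# ⊎ w ℂR.≈ ℂR.0#
  ℂ-noZeroDivisors {z} {w} zw≈0 with x*y≈0⇒x≈0∨y≈0
    (trans (sym (normSq-* z w)) (trans (normSq-cong zw≈0)
      (solve 0 (con ℤ.0ℤ :* con ℤ.0ℤ :+ con ℤ.0ℤ :* con ℤ.0ℤ := con ℤ.0ℤ) refl)))
  ... | inj₁ Nz≈0 = inj₁ (normSq≈0⇒≈0 Nz≈0)
  ... | inj₂ Nw≈0 = inj₂ (normSq≈0⇒≈0 Nw≈0)

  normSq-root-of-unity : ∀ {z} n → z ^ᶜ suc n ℂR.≈ ℂR.1# → normSq z ≤ 1#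
  normSq-root-of-unity {z} n z^n≈1 = ≮⇒≥ λ 1<N → <-irrefl refl (begin-strict
    1#                     ≈⟨ 1^k≈1 (suc n) ⟨
    1# ^ suc n             <⟨ ^-monoˡ-< n (inj₁ 0<1) 1<N ⟩
    normSq z ^ suc n       ≈⟨ normSq-^ z (suc n) ⟨
    normSq (z ^ᶜ suc n)    ≈⟨ normSq-cong z^n≈1 ⟩
    normSq ℂR.1#           ≈⟨ normSq-1 ⟩
    1#                     ∎)
    where
    1^k≈1 : ∀ k → 1# ^ k ≈ 1#
    1^k≈1 zero    = refl
    1^k≈1 (suc k) = trans (*-identityˡ _) (1^k≈1 k)

  infix 4 _≤□_

  -- A box norm, so that the triangle inequality holds componentwise.
  record _≤□_ (z : ℂ) (M : ℕ) : Set ℓ where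
    constructor _,_
    field
      re-bound : ∣ re z ∣≤ fromℕ M
      im-bound : ∣ im z ∣≤ fromℕ M

  ≤□-cong : ∀ {z w M} → z ℂR.≈ w → z ≤□ M → w ≤□ M
  ≤□-cong (p , q) (b , b′) = ∣∣≤-cong p b , ∣∣≤-cong q b′

  ≤□-mono : ∀ {z M N} → M ℕ.≤ N → z ≤□ M → z ≤□ N
  ≤□-mono M≤N (b , b′) = ∣∣≤-mono (fromℕ-mono-≤ M≤N) b , ∣∣≤-mono (fromℕ-mono-≤ M≤N) b′

  0≤□ : ∀ M → ℂR.0# ≤□ M
  0≤□ M = ∣0∣≤ (0≤fromℕ M) , ∣0∣≤ (0≤fromℕ M)

  -≤□ : ∀ {z M} → z ≤□ M → ℂR.- z ≤□ M
  -≤□ (b , b′) = ∣-∣≤ b , ∣-∣≤ b′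

  +≤□ : ∀ {z w M N} → z ≤□ M → w ≤□ N → z ℂR.+ w ≤□ M ℕ.+ N
  +≤□ {M = M} {N} (b , b′) (d , d′) =
    ∣∣≤-mono (≤-reflexive (sym (fromℕ-+ M N))) (∣+∣≤ b d) ,
    ∣∣≤-mono (≤-reflexive (sym (fromℕ-+ M N))) (∣+∣≤ b′ d′)

  -- The box norm is not multiplicative: each coordinate of the product is a sum of two terms of
  -- size at most M, whence the doubling.
  *≤□ : ∀ {z w M} → z ≤□ M → normSq w ≤ 1# → z ℂR.* w ≤□ M ℕ.+ M
  *≤□ {z} {w} {M} (b , b′) Nw≤1 =
    ∣∣≤-mono M+M (∣+∣≤ (∣*∣≤ b re-w) (∣-∣≤ (∣*∣≤ b′ im-w))) ,
    ∣∣≤-mono M+M (∣+∣≤ (∣*∣≤ b im-w) (∣*∣≤ b′ re-w))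
    where
    1*1 : 1# ≤ 1# * 1#
    1*1 = ≤-reflexive (sym (*-identityˡ 1#))
    re-w : ∣ re w ∣≤ 1#
    re-w = x*x≤y*y⇒∣x∣≤y (inj₁ 0<1) (≤-trans (re*re≤normSq w) (≤-trans Nw≤1 1*1))
    im-w : ∣ im w ∣≤ 1#
    im-w = x*x≤y*y⇒∣x∣≤y (inj₁ 0<1) (≤-trans (im*im≤normSq w) (≤-trans Nw≤1 1*1))
    M+M : fromℕ M * 1# + fromℕ M * 1# ≤ fromℕ (M ℕ.+ M)
    M+M = ≤-reflexive (trans (+-cong (*-identityʳ _) (*-identityʳ _)) (sym (fromℕ-+ M M)))

  -- The box itself gives 2M². The weaker 4M² is the square of a natural number, so the bound on the
  -- modulus stays a natural number.
  ≤□⇒normSq≤ : ∀ {z M} → z ≤□ M → normSq z ≤ fromℕ (2 ℕ.* M) * fromℕ (2 ℕ.* M)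
  ≤□⇒normSq≤ {z} {M} (b , b′) = begin
    normSq z                               ≤⟨ +-mono-≤ (proj₂ (∣*∣≤ b b)) (proj₂ (∣*∣≤ b′ b′)) ⟩
    m * m + m * m                          ≈⟨ +-identityʳ _ ⟨
    (m * m + m * m) + 0#                   ≤⟨ +-monoʳ-≤ _ 0≤2mm ⟩
    (m * m + m * m) + (m * m + m * m)      ≈⟨ solve 1 (λ m → (m :* m :+ m :* m) :+ (m :* m :+ m :* m) :=
      (m :+ (m :+ con ℤ.0ℤ)) :* (m :+ (m :+ con ℤ.0ℤ))) refl m ⟩
    (m + (m + 0#)) * (m + (m + 0#))        ≈⟨ *-cong 2m 2m ⟨
    fromℕ (2 ℕ.* M) * fromℕ (2 ℕ.* M)      ∎
    where
    m = fromℕ M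
    0≤m = 0≤fromℕ M
    0≤2mm = ≤-respˡ-≈ (+-identityˡ 0#) (+-mono-≤ (*-nonneg 0≤m 0≤m) (*-nonneg 0≤m 0≤m))
    2m : fromℕ (2 ℕ.* M) ≈ m + (m + 0#)
    2m = trans (fromℕ-+ M (M ℕ.+ 0)) (+-congˡ (fromℕ-+ M 0))

-- Frobenius norm estimates

module Norms {ℓ} (R : CompleteOrderedField ℓ) where
  open OrderedField R
  open ComplexNumbers R
  open Cyclotomic R using (re; im; ∣_∣; ‖_‖; Matrix)
  open SemiringSum semiring using (sum)
  open Solver using (solve; _:=_; _:+_; _:*_; con)
  open ≤-Reasoning

  sum-nonneg : ∀ {m} (f : Fin m → ℝ) → (∀ i → 0# ≤ f i) → 0# ≤ sum f
  sum-nonneg {zero}  f 0≤f = ≤-refl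
  sum-nonneg {suc m} f 0≤f = ≤-respˡ-≈ (+-identityˡ 0#)
    (+-mono-≤ (0≤f Fin.zero) (sum-nonneg (f ∘ Fin.suc) (0≤f ∘ Fin.suc)))

  sum-upper : ∀ {m} (f : Fin m → ℝ) {b} → (∀ i → f i ≤ b) → sum f ≤ fromℕ m * b
  sum-upper {zero}  f {b} f≤b = ≤-reflexive (sym (zeroˡ b))
  sum-upper {suc m} f {b} f≤b = begin
    f Fin.zero + sum (f ∘ Fin.suc)   ≤⟨ +-mono-≤ (f≤b Fin.zero) (sum-upper (f ∘ Fin.suc) (f≤b ∘ Fin.suc)) ⟩
    b + fromℕ m * b                  ≈⟨ solve 2 (λ b m → b :+ m :* b := (con ℤ.1ℤ :+ m) :* b) refl b (fromℕ m) ⟩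
    fromℕ (suc m) * b                ∎

  ∣∣^2-bounds : ∀ {z} M → normSq z ≤ fromℕ M * fromℕ M →
                (0# ≤ ∣ z ∣ ^ 2) × (∣ z ∣ ^ 2 ≤ fromℕ M * fromℕ M)
  ∣∣^2-bounds {z} M N≤ = 0≤x^k 2 0≤∣z∣ ,
    ≤-respʳ-≈ (*-congˡ (*-identityʳ _)) (^-monoˡ-≤ 2 0≤∣z∣ (√-upper 0≤ (0≤fromℕ M) N≤′))
    where
    N≈ : normSq z ≈ re z ^ 2 + im z ^ 2
    N≈ = sym (+-cong (*-congˡ (*-identityʳ _)) (*-congˡ (*-identityʳ _)))
    0≤ : 0# ≤ re z ^ 2 + im z ^ 2
    0≤ = ≤-respʳ-≈ N≈ (normSq-nonneg z)
    N≤′ : re z ^ 2 + im z ^ 2 ≤ fromℕ M * fromℕ M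
    N≤′ = ≤-respˡ-≈ N≈ N≤
    0≤∣z∣ : 0# ≤ ∣ z ∣
    0≤∣z∣ = √-nonneg 0≤ (0≤fromℕ M) N≤′

  ‖‖-bounds : ∀ {m} (A : Matrix m) {M} → (∀ i j → normSq (A i j) ≤ fromℕ M * fromℕ M) →
              (0# ≤ ‖ A ‖) × (‖ A ‖ ≤ fromℕ (m ℕ.* M))
  ‖‖-bounds {m} A {M} N≤ = √-nonneg 0≤Σ (0≤fromℕ (m ℕ.* M)) Σ≤ , √-upper 0≤Σ (0≤fromℕ (m ℕ.* M)) Σ≤
    where
    0≤Σ : 0# ≤ sum (λ i → sum (λ j → ∣ A i j ∣ ^ 2))
    0≤Σ = sum-nonneg _ (λ i → sum-nonneg _ (λ j → proj₁ (∣∣^2-bounds M (N≤ i j))))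
    Σ≤ : sum (λ i → sum (λ j → ∣ A i j ∣ ^ 2)) ≤ fromℕ (m ℕ.* M) * fromℕ (m ℕ.* M)
    Σ≤ = begin
      sum (λ i → sum (λ j → ∣ A i j ∣ ^ 2))
        ≤⟨ sum-upper _ (λ i → sum-upper _ (λ j → proj₂ (∣∣^2-bounds M (N≤ i j)))) ⟩
      fromℕ m * (fromℕ m * (fromℕ M * fromℕ M))
        ≈⟨ solve 2 (λ m M → m :* (m :* (M :* M)) := (m :* M) :* (m :* M)) refl (fromℕ m) (fromℕ M) ⟩
      (fromℕ m * fromℕ M) * (fromℕ m * fromℕ M)
        ≈⟨ *-cong (fromℕ-* m M) (fromℕ-* m M) ⟨
      fromℕ (m ℕ.* M) * fromℕ (m ℕ.* M)
        ∎

-- Residues coprime to n and sieving by primes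

[_⋯1] : ℕ → List ℕ
[ n ⋯1] = map suc (downFrom n)

primesOf : ℕ → List ℕ
primesOf n = filter (λ p → prime? p ×-dec (p ∣? n)) (upTo (suc n))

-- The index sets met while sieving. Two parameters make the family closed under a step: the indices
-- divisible by a further prime p form the set for `ps` and `p * d`, the others the set for `p ∷ ps`
-- and d. The parameters `primesOf n` and 1 select the indices coprime to n.
Sieved : List ℕ → ℕ → Pred ℕ _
Sieved ps d t = (d ∣ t) × All (_∤ t) ps

sieved? : ∀ ps d → Decidable (Sieved ps d)
sieved? ps d t = (d ∣? t) ×-dec All.all? (λ p → ¬? (p ∣? t)) ps

multiples : ℕ → ℕ → List ℕ
multiples d zero    = []
multiples d (suc e) = suc e ℕ.* d ∷ multiples d e

∃-prime-divisor : ∀ {d} → .{{NonZero d}} → d ≢ 1 → ∃[ p ] Prime p × p ∣ d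
∃-prime-divisor {d} d≢1 = go (factors f) (isFactorisation f) (factorsPrime f)
  where
  open PrimeFactorisation
  f = factorise d
  go : ∀ ps → d ≡ product ps → All Prime ps → ∃[ p ] Prime p × p ∣ d
  go []       d≡1  _        = contradiction d≡1 d≢1
  go (p ∷ ps) d≡   (pp ∷ _) = p , pp , divides (product ps) (≡.trans d≡ (ℕ.*-comm p (product ps)))

coprime⇒sieved : ∀ {n t} → Coprime t n → Sieved (primesOf n) 1 t
coprime⇒sieved {n} {t} c = 1∣ t , All.map
  (λ (pr , p∣n) p∣t → ¬prime[1] (≡.subst Prime (c (p∣t , p∣n)) pr))
  (all-filter (λ p → prime? p ×-dec (p ∣? n)) (upTo (suc n)))

sieved⇒coprime : ∀ {n t} → .{{NonZero n}} → Sieved (primesOf n) 1 t → Coprime t n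
sieved⇒coprime {n} {t} (_ , ∤t) {zero}  (_ , 0∣n) = contradiction (0∣⇒≡0 0∣n) (ℕ.≢-nonZero⁻¹ n)
sieved⇒coprime {n} {t} (_ , ∤t) {suc d} (d∣t , d∣n) with suc d ℕ.≟ 1
... | yes d≡1 = d≡1
... | no  d≢1 = let p , pr , p∣d = ∃-prime-divisor d≢1 ; p∣n = ∣-trans p∣d d∣n in
  contradiction (∣-trans p∣d d∣t)
    (All.lookup ∤t (∈-filter⁺ (λ p → prime? p ×-dec (p ∣? n)) (∈-upTo⁺ (s≤s (∣⇒≤ p∣n))) (pr , p∣n)))

[⋯1]↭ : ∀ n → [ n ⋯1] ↭ map suc (upTo n)
[⋯1]↭ n = map⁺ suc (↭-trans (↭-reflexive (≡.sym (List.reverse-upTo n))) (↭-reverse (upTo n)))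

length-sieved≡φ : ∀ n → .{{NonZero n}} → length (filter (sieved? (primesOf n) 1) [ n ⋯1]) ≡ φ n
length-sieved≡φ n = ≡.trans
  (≡.cong length (List.filter-≐ (sieved? (primesOf n) 1) (λ j → coprime? j n)
    (sieved⇒coprime , coprime⇒sieved) [ n ⋯1]))
  (↭-length (filter-↭ (λ j → coprime? j n) ([⋯1]↭ n)))

φ≤ : ∀ n → φ n ℕ.≤ n
φ≤ n = ℕ.≤-trans (List.length-filter (λ j → coprime? j n) (map suc (upTo n)))
  (ℕ.≤-reflexive (≡.trans (List.length-map suc (upTo n)) (List.length-upTo n)))

-- Exactly d numbers separate consecutive multiples of `suc d`; `skip` discards them.
filter-[⋯1]-multiples : ∀ d e →
  filter (sieved? [] (suc d)) [ e ℕ.* suc d ⋯1] ≡ multiples (suc d) e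
filter-[⋯1]-multiples d zero    = ≡.refl
filter-[⋯1]-multiples d (suc e) = ≡.trans
  (List.filter-accept (sieved? [] (suc d)) (n∣m*n (suc e) , []))
  (≡.cong (suc e ℕ.* suc d ∷_) (≡.trans (skip d ℕ.≤-refl) (filter-[⋯1]-multiples d e)))
  where
  skip : ∀ r → r ℕ.≤ d →
    filter (sieved? [] (suc d)) [ r ℕ.+ e ℕ.* suc d ⋯1] ≡ filter (sieved? [] (suc d)) [ e ℕ.* suc d ⋯1]
  skip zero    _   = ≡.refl
  skip (suc r) r<d = ≡.trans
    (List.filter-reject (sieved? [] (suc d)) λ (d∣ , _) →
      ℕ.<⇒≱ (s≤s r<d) (∣⇒≤ (∣m+n∣m⇒∣n (≡.subst (suc d ∣_) (ℕ.+-comm (suc r) (e ℕ.* suc d)) d∣) (n∣m*n e))))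
    (skip r (ℕ.<⇒≤ r<d))

prime-* : ∀ {p d n} → Prime p → p ∤ d → p ∣ n → d ∣ n → p ℕ.* d ∣ n
prime-* {p} {d} pr p∤d p∣n (divides q ≡.refl) with euclidsLemma q d pr p∣n
... | inj₁ p∣q = *-pres-∣ p∣q ∣-refl
... | inj₂ p∣d = contradiction p∣d p∤d

^2^-suc : ∀ m j → m ℕ.^ (2 ℕ.^ j) ℕ.* m ℕ.^ (2 ℕ.^ j) ≡ m ℕ.^ (2 ℕ.^ suc j)
^2^-suc m j = ≡.trans (≡.sym (ℕ.^-distribˡ-+-* m (2 ℕ.^ j) (2 ℕ.^ j)))
  (≡.cong (λ x → m ℕ.^ (2 ℕ.^ j ℕ.+ x)) (≡.sym (ℕ.+-identityʳ (2 ℕ.^ j))))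

^-distribʳ-* : ∀ m n k → (m ℕ.* n) ℕ.^ k ≡ m ℕ.^ k ℕ.* n ℕ.^ k
^-distribʳ-* m n zero    = ≡.refl
^-distribʳ-* m n (suc k) = ≡.trans (≡.cong (m ℕ.* n ℕ.*_) (^-distribʳ-* m n k))
  (solve 4 (λ m n x y → m :* n :* (x :* y) := m :* x :* (n :* y)) ≡.refl m n (m ℕ.^ k) (n ℕ.^ k))
  where open +-*-Solver

-- The left side is the product of the two norm bounds. `m * 1` belongs to V, whose entries have
-- modulus at most 1. In the other factor H bounds the coefficients of the interpolating
-- polynomials, `H + H` accounts for the multiplication by roots of unity, and the last 2 for the
-- passage from the box to the modulus.
condition-number-bound : ∀ n .{{_ : NonZero n}} {m H j k} → m ℕ.≤ n → H ≡ (2 ℕ.* (n ℕ.+ n)) ℕ.^ (2 ℕ.^ j) → j ℕ.≤ k →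
  m ℕ.* 1 ℕ.* (m ℕ.* (2 ℕ.* (H ℕ.+ H))) ℕ.≤ 4 ℕ.^ (1 ℕ.+ 2 ℕ.^ k) ℕ.* n ℕ.^ (2 ℕ.^ k ℕ.+ 2)
condition-number-bound n {m} {H} {j} {k} m≤n H≡ j≤k = begin
  m ℕ.* 1 ℕ.* (m ℕ.* (2 ℕ.* (H ℕ.+ H)))  ≤⟨ ℕ.*-mono-≤ (ℕ.*-monoˡ-≤ 1 m≤n) (ℕ.*-mono-≤ m≤n (ℕ.*-monoʳ-≤ 2 (ℕ.+-mono-≤ H≤ H≤))) ⟩
  n ℕ.* 1 ℕ.* (n ℕ.* (2 ℕ.* (H′ ℕ.+ H′)))  ≡⟨ rearrange n (4 ℕ.^ e) (n ℕ.^ e) ⟩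
  4 ℕ.* 4 ℕ.^ e ℕ.* (n ℕ.^ e ℕ.* (n ℕ.* (n ℕ.* 1)))  ≡⟨ ≡.cong (4 ℕ.^ (1 ℕ.+ e) ℕ.*_) (ℕ.^-distribˡ-+-* n e 2) ⟨
  4 ℕ.^ (1 ℕ.+ e) ℕ.* n ℕ.^ (e ℕ.+ 2)  ∎
  where
  open ℕ.≤-Reasoning
  open +-*-Solver
  e H′ : ℕ
  e = 2 ℕ.^ k
  H′ = 4 ℕ.^ e ℕ.* n ℕ.^ e
  rearrange : ∀ n x y → n ℕ.* 1 ℕ.* (n ℕ.* (2 ℕ.* (x ℕ.* y ℕ.+ x ℕ.* y))) ≡ 4 ℕ.* x ℕ.* (y ℕ.* (n ℕ.* (n ℕ.* 1)))
  rearrange = solve 3 (λ n x y →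
    n :* con 1 :* (n :* (con 2 :* (x :* y :+ x :* y))) := con 4 :* x :* (y :* (n :* (n :* con 1)))) ≡.refl
  4n : ∀ n → 2 ℕ.* (n ℕ.+ n) ≡ 4 ℕ.* n
  4n = solve 1 (λ n → con 2 :* (n :+ n) := con 4 :* n) ≡.refl
  H≤ : H ℕ.≤ H′
  H≤ = begin
    H                                ≡⟨ H≡ ⟩
    (2 ℕ.* (n ℕ.+ n)) ℕ.^ (2 ℕ.^ j)  ≡⟨ ≡.cong (ℕ._^ (2 ℕ.^ j)) (4n n) ⟩
    (4 ℕ.* n) ℕ.^ (2 ℕ.^ j)          ≤⟨ ℕ.^-monoʳ-≤ (4 ℕ.* n) {{ℕ.m*n≢0 4 n}} (ℕ.^-monoʳ-≤ 2 j≤k) ⟩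
    (4 ℕ.* n) ℕ.^ e                  ≡⟨ ^-distribʳ-* 4 n e ⟩
    H′                               ∎

-- Coefficient growth under multiplication and division by f

module CyclotomicBounds {ℓ} (R : CompleteOrderedField ℓ) where
  open ComplexNumbers R
  open CommutativeRing ℂ-commutativeRing hiding (zero)
  open PowerSeries ℂ-commutativeRing
  open Evaluation ℂ-commutativeRing
  open CommutativeSemiringExp commutativeSemiring using (_^_; ^-congˡ; ^-assocʳ; ^-distrib-*)
  open IntegerCoefficients ℂ-commutativeRing using (module Solver)
  open Solver using (solve; _:=_; _:+_; _:*_; _:-_; :-_; con)
  open Cyclotomic R using (ℂ; IsPrimitiveRoot)
  open SetoidReasoning setoid

  module Costs (N : ℕ) where

    -- Only the first N coefficients count: division by 1 - xᵉ can let coefficients grow linearly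
    -- with the degree, so no uniform bound for all of them survives it.
    BoundedBy : ℕ → Series → Set ℓ
    BoundedBy M s = ∀ {k} → k ℕ.< N → s k ≤□ M

    BoundedBy-resp-≋ : ∀ {M s t} → s ≋ t → BoundedBy M s → BoundedBy M t
    BoundedBy-resp-≋ s≋t b k<N = ≤□-cong (s≋t _) (b k<N)

    record Cost (O : Series → Series) (α β : ℕ) : Set ℓ where
      field
        forward  : ∀ {M s} → BoundedBy M s → BoundedBy (α ℕ.* M) (O s)
        backward : ∀ {M s} → BoundedBy M (O s) → BoundedBy (β ℕ.* M) s
    open Cost public

    -- Write s = O₂ v. Forward, v is found from s by dividing by O₂ at cost β, and O₁ s = O v then
    -- costs α. Backward, v is found from O₁ s = O v at cost β, and s = O₂ v then costs α. Either
    -- way the quotient O₁ costs α β.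
    Cost-quotient : ∀ {O₁ O₂ O α β} → (∀ s → O s ≋ O₁ (O₂ s)) →
                    (∀ {s t} → s ≋ t → O₁ s ≋ O₁ t) → (∀ s → ∃[ v ] O₂ v ≋ s) →
                    Cost O α β → Cost O₂ α β → Cost O₁ (α ℕ.* β) (α ℕ.* β)
    Cost-quotient {O₁} {O₂} {O} {α} {β} O≋O₁O₂ O₁-cong O₂-surjective cost cost₂ = record
      { forward  = λ {M} {s} b → let v , O₂v≋s = O₂-surjective s in
          ≡.subst (λ M → BoundedBy M (O₁ s)) (≡.sym (ℕ.*-assoc α β M)) $
          BoundedBy-resp-≋ (≋-trans (O≋O₁O₂ v) (O₁-cong O₂v≋s)) $
          forward cost $ backward cost₂ $ BoundedBy-resp-≋ (≋-sym O₂v≋s) b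
      ; backward = λ {M} {s} b → let v , O₂v≋s = O₂-surjective s in
          ≡.subst (λ M → BoundedBy M s) (≡.sym (ℕ.*-assoc α β M)) $
          BoundedBy-resp-≋ O₂v≋s $
          forward cost₂ $ backward cost $
          BoundedBy-resp-≋ (≋-sym (≋-trans (O≋O₁O₂ v) (O₁-cong O₂v≋s))) b
      }

    shift-≤□ : ∀ e {s k M} → (∀ {j} → j ℕ.≤ k → s j ≤□ M) → shift e s k ≤□ M
    shift-≤□ zero    {k = k}         b = b ℕ.≤-refl
    shift-≤□ (suc e) {k = zero}  {M} b = 0≤□ M
    shift-≤□ (suc e) {k = suc k}     b = shift-≤□ e (b ∘ ℕ.m≤n⇒m≤1+n)

    shift-suc-≤□ : ∀ e {s k M} → (∀ {j} → j ℕ.< k → s j ≤□ M) → shift (suc e) s k ≤□ M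
    shift-suc-≤□ e {k = zero}  {M} b = 0≤□ M
    shift-suc-≤□ e {k = suc k}     b = shift-≤□ e (b ∘ s≤s)

    -- Each coefficient of s is the one of `O s` plus a coefficient of s of strictly smaller degree
    -- (the shift is by `suc e`, never by 0). By strong induction the coefficient of degree j is at
    -- most (j + 1) M, which is at most N M inside the window.
    Cost-1-xᵉ : ∀ {O} e → (∀ s → O s ≋ (λ k → s k - shift (suc e) s k)) → Cost O 2 N
    Cost-1-xᵉ {O} e O≋ = record
      { forward  = λ {M} {s} b {k} k<N →
          ≤□-mono (ℕ.≤-reflexive (≡.cong (M ℕ.+_) (≡.sym (ℕ.+-identityʳ M)))) $
          ≤□-cong (sym (O≋ s k)) $
          +≤□ (b k<N) (-≤□ (shift-suc-≤□ e (λ j<k → b (ℕ.<-trans j<k k<N))))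
      ; backward = λ {M} {s} b {k} k<N →
          ≤□-mono (ℕ.*-monoˡ-≤ M k<N) (growth b k<N k ℕ.≤-refl)
      }
      where
      growth : ∀ {M s} → BoundedBy M (O s) → ∀ {k} → k ℕ.< N → ∀ j → j ℕ.≤ k → s j ≤□ suc j ℕ.* M
      growth {M} {s} b {k} k<N j j≤k = below (suc j) (ℕ.≤-trans (s≤s j≤k) k<N) ℕ.≤-refl
        where
        step : ∀ {j} → j ℕ.< N → (∀ {i} → i ℕ.< j → s i ≤□ suc i ℕ.* M) → s j ≤□ suc j ℕ.* M
        step {j} j<N ih =
          ≤□-cong (trans (+-congʳ (O≋ s j)) (solve 2 (λ x y → (x :- y) :+ y := x) refl (s j) (shift (suc e) s j))) $
          +≤□ (b j<N) (shift-suc-≤□ e (λ {i} i<j → ≤□-mono (ℕ.*-monoˡ-≤ M i<j) (ih i<j)))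
        below : ∀ m {j} → m ℕ.≤ N → j ℕ.< m → s j ≤□ suc j ℕ.* M
        below (suc m) m<N (s≤s j≤m) =
          step (ℕ.≤-trans (s≤s j≤m) m<N) (λ i<j → below m (ℕ.<⇒≤ m<N) (ℕ.≤-trans i<j j≤m))

    -- One sieving step turns a product into a quotient of two such products of equal cost,
    -- so that α * β is squared.
    α β : ℕ → ℕ
    α zero    = 2
    α (suc j) = α j ℕ.* β j
    β zero    = N
    β (suc j) = α j ℕ.* β j

    α*β : ∀ j → α j ℕ.* β j ≡ (2 ℕ.* N) ℕ.^ (2 ℕ.^ j)
    α*β zero    = ≡.sym (ℕ.*-identityʳ (2 ℕ.* N))
    α*β (suc j) = ≡.trans (≡.cong₂ ℕ._*_ (α*β j) (α*β j)) (^2^-suc (2 ℕ.* N) j)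

  module _ {n′ : ℕ} {ζ : ℂ} (ζ-primitive : IsPrimitiveRoot (suc n′) ζ) where

    private
      n : ℕ
      n = suc n′

    ζ^n≈1 : ζ ^ n ≈ 1#
    ζ^n≈1 = proj₁ ζ-primitive

    sieve : List ℕ → ℕ → List ℂ
    sieve ps d = map (ζ ^_) (filter (sieved? ps d) [ n ⋯1])

    ∏T-multiples : ∀ d e s → ∏T (map (ζ ^_) (multiples d e)) s ≋ ∏T (powers (ζ ^ d) e) s
    ∏T-multiples d zero    s = λ _ → refl
    ∏T-multiples d (suc e) s = ≋-trans (T-congʳ _ (∏T-multiples d e s)) (T-congˡ _ (begin
      ζ ^ (suc e ℕ.* d)    ≡⟨ ≡.cong (ζ ^_) (ℕ.*-comm (suc e) d) ⟩
      ζ ^ (d ℕ.* suc e)    ≈⟨ ^-assocʳ ζ d (suc e) ⟨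
      (ζ ^ d) ^ suc e      ∎))

    -- For n = (e + 1) d the power of ζ with exponent d is a primitive root of unity of order e + 1,
    -- and the multiples of d up to n run through its powers. The product of all these factors is
    -- therefore 1 - x^(n/d).
    ∏T-sieve[] : ∀ {d e} → n ≡ suc e ℕ.* d → ∀ s → ∏T (sieve [] d) s ≋ (λ k → s k - shift (suc e) s k)
    ∏T-sieve[] {zero}  {e} n≡ s = contradiction (≡.trans n≡ (ℕ.*-zeroʳ (suc e))) λ ()
    ∏T-sieve[] {suc d} {e} n≡ s = ≋-trans
      (λ k → reflexive (≡.cong (λ ts → ∏T (map (ζ ^_) ts) s k) (≡.trans
        (≡.cong (λ n → filter (sieved? [] (suc d)) [ n ⋯1]) n≡) (filter-[⋯1]-multiples d (suc e)))))
      (≋-trans (∏T-multiples (suc d) (suc e) s)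
      (∏T-powers ℂ-noZeroDivisors
        (trans (^-assocʳ ζ (suc d) (suc e)) (trans (reflexive (≡.cong (ζ ^_) (≡.trans (ℕ.*-comm (suc d) (suc e)) (≡.sym n≡)))) ζ^n≈1))
        (λ {k} 1≤k k<e η^k≈1 → proj₂ ζ-primitive (suc d ℕ.* k)
          (ℕ.*-mono-≤ {1} {suc d} (s≤s z≤n) 1≤k)
          (≡.subst (suc d ℕ.* k ℕ.<_) (≡.trans (ℕ.*-comm (suc d) (suc e)) (≡.sym n≡)) (ℕ.*-monoʳ-< (suc d) k<e))
          (trans (sym (^-assocʳ ζ (suc d) k)) η^k≈1))
        s))

    -- The indices for `ps` and d are split according to divisibility by p. Read as a quotient, this
    -- adds p to the sieving primes.
    ∏T-sieve-∷ : ∀ {p ps d} → (∀ {t} → d ∣ t → p ∣ t → p ℕ.* d ∣ t) → ∀ s →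
                 ∏T (sieve ps d) s ≋ ∏T (sieve (p ∷ ps) d) (∏T (sieve ps (p ℕ.* d)) s)
    ∏T-sieve-∷ {p} {ps} {d} combine = ∏T-filter-⊎
      (sieved? ps d) (sieved? (p ∷ ps) d) (sieved? ps (p ℕ.* d))
      (λ { (d∣t , _ ∷ ∤t) → d∣t , ∤t })
      (λ (pd∣t , ∤t) → m*n∣⇒n∣ p d pd∣t , ∤t)
      split
      (λ { (_ , p∤t ∷ _) (pd∣t , _) → p∤t (m*n∣⇒m∣ p d pd∣t) })
      (ζ ^_) [ n ⋯1]
      where
      split : ∀ {t} → Sieved ps d t → Sieved (p ∷ ps) d t ⊎ Sieved ps (p ℕ.* d) t
      split {t} (d∣t , ∤t) with p ∣? t
      ... | yes p∣t = inj₂ (combine d∣t p∣t , ∤t)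
      ... | no  p∤t = inj₁ (d∣t , p∤t ∷ ∤t)

    module _ (N : ℕ) where
      open Costs N

      -- Numerator and denominator of the step involve the same shorter list of primes, so their
      -- costs coincide and depend on its length only. No remaining prime divides d; this persists
      -- for `p * d` because the primes are distinct, and it keeps `p * d` a divisor of n.
      Cost-sieve : ∀ ps d → d ∣ n → Unique ps → All (λ p → Prime p × p ∣ n × p ∤ d) ps →
                   Cost (∏T (sieve ps d)) (α (length ps)) (β (length ps))
      Cost-sieve []       d (divides zero ())    _ _
      Cost-sieve []       d (divides (suc e) n≡) _ _ = Cost-1-xᵉ e (∏T-sieve[] n≡)
      Cost-sieve (p ∷ ps) d d∣n (p≢ps ∷ unique) ((pr , p∣n , p∤d) ∷ prs) =
        Cost-quotient (∏T-sieve-∷ (λ d∣t p∣t → prime-* pr p∤d p∣t d∣t)) (∏T-cong (sieve (p ∷ ps) d))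
          (λ s → ∏T⁻¹ (sieve ps (p ℕ.* d)) s , ∏T-∏T⁻¹ (sieve ps (p ℕ.* d)) s)
          (Cost-sieve ps d d∣n unique prs)
          (Cost-sieve ps (p ℕ.* d) (prime-* pr p∤d p∣n d∣n) unique
            (All.zipWith (λ { (p≢q , (qr , q∣n , q∤d)) → qr , q∣n ,
              [ (λ q∣p → [ (λ { ≡.refl → ¬prime[1] qr }) , (λ q≡p → p≢q (≡.sym q≡p)) ]′ (prime⇒irreducible pr q∣p)) , q∤d ]′
              ∘ euclidsLemma p d qr }) (p≢ps , prs)))

      Cost-cyclotomic : Cost (∏T (sieve (primesOf n) 1)) (α (ω n)) (β (ω n))
      Cost-cyclotomic = Cost-sieve (primesOf n) 1 (1∣ n)
        (Unique.filter⁺ (λ p → prime? p ×-dec (p ∣? n)) (Unique.upTo⁺ (suc n)))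
        (All.map (λ (pr , p∣n) → pr , p∣n , λ p∣1 → ¬prime[1] (≡.subst Prime (∣1⇒≡1 p∣1) pr))
          (all-filter (λ p → prime? p ×-dec (p ∣? n)) (upTo (suc n))))

    -- The product of 1 - ζᵗ x over all t from 1 to n is 1 - xⁿ, which vanishes at x; hence x is
    -- inverse to some power of ζ, and primitivity of x forces the exponent to be coprime to n.
    coprime-power-inverse : ∀ {x} → IsPrimitiveRoot n x → Any (λ a → a * x ≈ 1#) (sieve (primesOf n) 1)
    coprime-power-inverse {x} (x^n≈1 , x-primitive) =
      let t , t∈ , ζ^t*x≈1 = find (Any.map⁻ (∏T-root ℂ-noZeroDivisors (sieve [] 1) root 1≉0)) in
      Any.map⁺ (lose (∈-filter⁺ (sieved? (primesOf n) 1) (proj₁ (∈-filter⁻ (sieved? [] 1) {xs = [ n ⋯1]} t∈))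
        (coprime⇒sieved (coprime t ζ^t*x≈1))) ζ^t*x≈1)
      where
      1≉0 : ¬ (1# ≈ 0#)
      1≉0 (eq , _) = 0≉1 (OrderedField.sym R eq)
        where open OrderedField R using (0≉1)
      length≡ : length (sieve [] 1) ℕ.+ 1 ≡ suc n
      length≡ = ≡.trans (ℕ.+-comm (length (sieve [] 1)) 1) (≡.cong suc (≡.trans (List.length-map (ζ ^_) (filter (sieved? [] 1) [ n ⋯1]))
        (≡.trans (≡.cong length (List.filter-all (sieved? [] 1) {[ n ⋯1]} (All.universal (λ t → 1∣ t , []) _)))
        (≡.trans (List.length-map suc (downFrom n)) (List.length-downFrom n)))))
      root : eval (length (sieve [] 1) ℕ.+ 1) (∏T (sieve [] 1) δ) x ≈ 0#
      root = begin
        eval (length (sieve [] 1) ℕ.+ 1) (∏T (sieve [] 1) δ) x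
          ≡⟨ ≡.cong (λ m → eval m (∏T (sieve [] 1) δ) x) length≡ ⟩
        eval (suc n) (∏T (sieve [] 1) δ) x
          ≈⟨ eval-cong (suc n) x (λ {k} _ → ∏T-sieve[] (≡.sym (ℕ.*-identityʳ n)) δ k) ⟩
        eval n (λ k → δ k - shift n δ k) x + (0# - shift n δ n) * x ^ n
          ≈⟨ +-cong (eval-cong n x (λ k<n → trans (+-congˡ (-‿cong (shift-δ-< k<n))) (x-0#≈x _)))
               (*-cong (+-congˡ (-‿cong (shift-δ-≡ n))) x^n≈1) ⟩
        eval n δ x + (0# - 1#) * 1#
          ≈⟨ +-congʳ (eval-δ n′ x) ⟩
        1# + (0# - 1#) * 1#
          ≈⟨ solve 0 (con ℤ.1ℤ :+ (con ℤ.0ℤ :- con ℤ.1ℤ) :* con ℤ.1ℤ := con ℤ.0ℤ) refl ⟩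
        0#
          ∎
      -- Let g divide both t and n, and let b = n / g. Then n divides t b, so the b-th power of ζᵗ
      -- is 1 and that of x is 1 as well. As x is primitive, b cannot be smaller than n, which
      -- leaves g = 1.
      coprime : ∀ t → ζ ^ t * x ≈ 1# → Coprime t n
      coprime t ζ^t*x≈1 {g} (divides a t≡ag , divides b n≡bg) with b ℕ.<? n
      ... | yes b<n = contradiction (begin
        x ^ b                  ≈⟨ *-identityˡ _ ⟨
        1# * x ^ b             ≈⟨ *-congʳ (1^k≈1 a) ⟨
        1# ^ a * x ^ b         ≈⟨ *-congʳ (^-congˡ a ζ^n≈1) ⟨
        (ζ ^ n) ^ a * x ^ b    ≈⟨ *-congʳ (^-assocʳ ζ n a) ⟩
        ζ ^ (n ℕ.* a) * x ^ b  ≡⟨ ≡.cong (λ j → ζ ^ j * x ^ b) na≡tb ⟩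
        ζ ^ (t ℕ.* b) * x ^ b  ≈⟨ *-congʳ (^-assocʳ ζ t b) ⟨
        (ζ ^ t) ^ b * x ^ b    ≈⟨ ^-distrib-* (ζ ^ t) x b ⟨
        (ζ ^ t * x) ^ b        ≈⟨ ^-congˡ b ζ^t*x≈1 ⟩
        1# ^ b                 ≈⟨ 1^k≈1 b ⟩
        1#                     ∎) (x-primitive b 1≤b b<n)
        where
        1≤b : 1 ℕ.≤ b
        1≤b = ℕ.n≢0⇒n>0 λ { ≡.refl → contradiction n≡bg λ () }
        na≡tb : n ℕ.* a ≡ t ℕ.* b
        na≡tb = ≡.trans (≡.cong (ℕ._* a) n≡bg) (≡.trans (ℕ.*-assoc b g a)
          (≡.trans (≡.cong (b ℕ.*_) (≡.trans (ℕ.*-comm g a) (≡.sym t≡ag))) (ℕ.*-comm b t)))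
      ... | no  b≮n = ℕ.≤-antisym g≤1 1≤g
        where
        1≤g : 1 ℕ.≤ g
        1≤g = ℕ.n≢0⇒n>0 λ { ≡.refl → contradiction (≡.trans n≡bg (ℕ.*-zeroʳ b)) λ () }
        g≤1 : g ℕ.≤ 1
        g≤1 = ℕ.*-cancelˡ-≤ n (≡.subst₂ ℕ._≤_ (ℕ.*-comm g n) (≡.trans (≡.sym n≡bg) (≡.sym (ℕ.*-identityʳ n)))
          (≡.subst (ℕ._≤ b ℕ.* g) (ℕ.*-comm n g) (ℕ.*-monoˡ-≤ g (ℕ.≮⇒≥ b≮n))))

-- The inverse of the Vandermonde matrix

module VandermondeInverse {ℓ} (R : CompleteOrderedField ℓ) where
  open ComplexNumbers R
  open CommutativeRing ℂ-commutativeRing hiding (zero)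
  open PowerSeries ℂ-commutativeRing
  open Evaluation ℂ-commutativeRing
  open CommutativeSemiringExp commutativeSemiring using (_^_; ^-congˡ; ^-assocʳ; ^-distrib-*)
  open SemiringSum semiring using (sum; sum-cong-≋; *-distribˡ-sum; *-distribʳ-sum; ∑-comm)
  open IntegerCoefficients ℂ-commutativeRing using (module Solver)
  open Solver using (solve; _:=_; _:+_; _:*_; _:-_; :-_; con)
  open CyclotomicBounds R
  open Norms R
  open Cyclotomic R using (ℂ; _+i_; IsPrimitiveRoot; PrimitiveRoots; Matrix; Invertible; V; _*ᴹ_; _≈ᴹ_; 1ᴹ; Cond; fromℕ)
  open PrimitiveRoots
  open SetoidReasoning setoid
  module ℝF = OrderedField R
  open ℝF using (_≤_)

  sum-- : ∀ {m} (f g : Fin m → ℂ) → sum (λ a → f a - g a) ≈ sum f - sum g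
  sum-- {zero}  f g = sym (-‿inverseʳ 0#)
  sum-- {suc m} f g = trans (+-congˡ (sum-- (f ∘ Fin.suc) (g ∘ Fin.suc)))
    (solve 4 (λ a b c d → (a :- b) :+ (c :- d) := (a :+ c) :- (b :+ d)) refl
      (f Fin.zero) (g Fin.zero) (sum (f ∘ Fin.suc)) (sum (g ∘ Fin.suc)))

  sum-ones : ∀ n → sum {n} (λ _ → 1#) ≈ fromℕ n +i ℝF.0#
  sum-ones zero    = refl
  sum-ones (suc n) = trans (+-congˡ (sum-ones n)) (ℝF.refl , ℝF.+-identityˡ _)

  sum-≤□ : ∀ {m} (f : Fin m → ℂ) {M} → (∀ i → f i ≤□ M) → sum f ≤□ m ℕ.* M
  sum-≤□ {zero}  f f≤ = 0≤□ 0
  sum-≤□ {suc m} f f≤ = +≤□ (f≤ Fin.zero) (sum-≤□ (f ∘ Fin.suc) (f≤ ∘ Fin.suc))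

  module _ (n : ℕ) where
    fromℕ⁻¹ : ℂ
    fromℕ⁻¹ = (fromℕ (suc n) ℝF.⁻¹) +i ℝF.0#

    private
      c = fromℕ (suc n) ℝF.⁻¹

      0<n : ℝF.0# ℝF.< fromℕ (suc n)
      0<n = ℝF.fromℕ-mono-< {0} {suc n} (s≤s z≤n)

      c*n≈1 : c ℝF.* fromℕ (suc n) ℝF.≈ ℝF.1#
      c*n≈1 = ℝF.trans (ℝF.*-comm _ _) (ℝF.⁻¹-inverse _ λ n≈0 → ℝF.<-irrefl (ℝF.sym n≈0) 0<n)

      0≤c : ℝF.0# ≤ c
      0≤c = ℝF.≮⇒≥ λ c<0 → ℝF.≤⇒≯ (inj₁ ℝF.0<1)
        (ℝF.<-respʳ-≈ (ℝF.zeroˡ _) (ℝF.<-respˡ-≈ c*n≈1 (ℝF.*-monoˡ-< 0<n c<0)))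

    fromℕ⁻¹-inverse : fromℕ⁻¹ * (fromℕ (suc n) +i ℝF.0#) ≈ 1#
    fromℕ⁻¹-inverse =
      ℝF.trans (solveᴿ 2 (λ c n → c :*ᴿ n :-ᴿ conᴿ ℤ.0ℤ :*ᴿ conᴿ ℤ.0ℤ :=ᴿ c :*ᴿ n) ℝF.refl _ _) c*n≈1 ,
      solveᴿ 2 (λ c n → c :*ᴿ conᴿ ℤ.0ℤ :+ᴿ conᴿ ℤ.0ℤ :*ᴿ n :=ᴿ conᴿ ℤ.0ℤ) ℝF.refl _ _
      where open ℝF.Solver using () renaming
              (solve to solveᴿ; _:=_ to _:=ᴿ_; _:+_ to _:+ᴿ_; _:*_ to _:*ᴿ_; _:-_ to _:-ᴿ_; con to conᴿ)

    -- A mean of `suc n` numbers stays in their common box, so the summation over K costs no power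
    -- of n.
    fromℕ⁻¹*≤□ : ∀ {z M} → z ≤□ suc n ℕ.* M → fromℕ⁻¹ * z ≤□ M
    fromℕ⁻¹*≤□ {z} {M} (re≤ , im≤) =
      ℝF.∣∣≤-cong (solveᴿ 3 (λ c x y → c :*ᴿ x :=ᴿ c :*ᴿ x :-ᴿ conᴿ ℤ.0ℤ :*ᴿ y) ℝF.refl _ _ _) (bound re≤) ,
      ℝF.∣∣≤-cong (solveᴿ 3 (λ c x y → c :*ᴿ x :=ᴿ c :*ᴿ x :+ᴿ conᴿ ℤ.0ℤ :*ᴿ y) ℝF.refl _ _ _) (bound im≤)
      where
      open ℝF.Solver using () renaming
              (solve to solveᴿ; _:=_ to _:=ᴿ_; _:+_ to _:+ᴿ_; _:*_ to _:*ᴿ_; _:-_ to _:-ᴿ_; con to conᴿ)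
      bound : ∀ {x} → ℝF.∣ x ∣≤ fromℕ (suc n ℕ.* M) → ℝF.∣ c ℝF.* x ∣≤ fromℕ M
      bound x≤ = ℝF.∣∣≤-mono (ℝF.≤-reflexive
        (ℝF.trans (ℝF.*-congˡ (ℝF.fromℕ-* (suc n) M)) (ℝF.trans (ℝF.sym (ℝF.*-assoc _ _ _))
          (ℝF.trans (ℝF.*-congʳ c*n≈1) (ℝF.*-identityˡ _)))))
        (ℝF.∣*∣≤ (ℝF.≤-trans (ℝF.≤-respʳ-≈ ℝF.-0#≈0# (ℝF.neg-antimono-≤ 0≤c)) 0≤c , ℝF.≤-refl) x≤)

  module _ {n′ : ℕ} (ρ : PrimitiveRoots (suc n′)) where

    private
      n m : ℕ
      n = suc n′
      m = φ n

      -- Some primitive root has to serve as ζ; there is one because 1 is coprime to n, so that φ(n)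
      -- is positive.
      i₀ : Fin m
      i₀ = Fin.fromℕ< (List.filter-some (λ j → coprime? j n) (here (Coprime.1-coprimeTo n)))

      ζ₀-primitive : IsPrimitiveRoot n (ζ ρ i₀)
      ζ₀-primitive = primitivity ρ i₀

      as : List ℂ
      as = sieve ζ₀-primitive (primesOf n) 1

      length-as : length as ≡ m
      length-as = ≡.trans (List.length-map (ζ ρ i₀ ^_) (filter (sieved? (primesOf n) 1) [ n ⋯1])) (length-sieved≡φ n)

      -- Coefficients will be read at degrees k + K with k < φ(n) ≤ n and K ≤ n, all of them below
      -- 2n.
      open Costs (n ℕ.+ n)

      cost : Cost (∏T as) (α (ω n)) (β (ω n))
      cost = Cost-cyclotomic ζ₀-primitive (n ℕ.+ n)

      -- Dividing the series 1 by f costs β, truncation nothing, and multiplying by f again costs α.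
      H : ℕ
      H = α (ω n) ℕ.* (β (ω n) ℕ.* 1)

      g : Series
      g = ∏T⁻¹ as δ

      δ≤1 : BoundedBy 1 δ
      δ≤1 {zero}  _ = ℝF.∣∣≤-mono 1≤ (ℝF.≤-trans (ℝF.≤-respʳ-≈ ℝF.-0#≈0# (ℝF.neg-antimono-≤ (inj₁ ℝF.0<1))) (inj₁ ℝF.0<1) , ℝF.≤-refl) ,
                      ℝF.∣0∣≤ (ℝF.0≤fromℕ 1)
        where 1≤ = ℝF.≤-reflexive (ℝF.sym ℝF.fromℕ-1)
      δ≤1 {suc k} _ = 0≤□ 1

      -- f · (1/f truncated at degree K) = 1 + xᴷ (⋯)
      F : ℕ → Series
      F K = ∏T as (truncate K g)

      F≤H : ∀ K → BoundedBy H (F K)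
      F≤H K = forward cost (truncate-≤ (backward cost (BoundedBy-resp-≋ (≋-sym (∏T-∏T⁻¹ as δ)) δ≤1)))
        where
        truncate-≤ : ∀ {M s} → BoundedBy M s → BoundedBy M (truncate K s)
        truncate-≤ {M} {s} b {k} k<N with k ℕ.<? K
        ... | yes _ = b k<N
        ... | no  _ = 0≤□ M

      -- Index K stands for the exponent `suc K`, so that `Fin n` runs over the exponents 1, ..., n.
      h : ℕ → Series
      h K k = - F (suc K) (k ℕ.+ suc K)

      h≤H : ∀ (K : Fin n) (a : Fin m) → h (toℕ K) (toℕ a) ≤□ H
      h≤H K a = -≤□ (F≤H (suc (toℕ K)) (ℕ.+-mono-<-≤ (ℕ.<-≤-trans (Fin.toℕ<n a) (φ≤ n)) (Fin.toℕ<n K)))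

      x^K*h≈1 : ∀ K {x} → IsPrimitiveRoot n x → x ^ suc K * eval m (h K) x ≈ 1#
      x^K*h≈1 K {x} x-primitive = begin
        x ^ suc K * eval m (h K) x      ≈⟨ *-congˡ (eval-neg m (λ k → F (suc K) (k ℕ.+ suc K)) x) ⟩
        x ^ suc K * - E                 ≈⟨ solve 2 (λ y E → y :* :- E := con ℤ.1ℤ :- (con ℤ.1ℤ :+ y :* E)) refl (x ^ suc K) E ⟩
        1# - (1# + x ^ suc K * E)       ≈⟨ +-congˡ (-‿cong 1+x^K*E≈0) ⟩
        1# - 0#                         ≈⟨ x-0#≈x 1# ⟩
        1#                              ∎
        where
        E = eval m (λ k → F (suc K) (k ℕ.+ suc K)) x
        1+x^K*E≈0 : 1# + x ^ suc K * E ≈ 0#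
        1+x^K*E≈0 = begin
          1# + x ^ suc K * E                        ≈⟨ +-congʳ (eval-δ K x) ⟨
          -- Below degree `suc K` the truncated series is 1/f itself, so its product with f agrees
          -- there with the series 1.
          eval (suc K) δ x + x ^ suc K * E          ≈⟨ +-congʳ (eval-cong (suc K) x λ {k} k<K →
            trans (sym (∏T-∏T⁻¹ as δ k)) (∏T-local as (sym ∘ truncate-< g) k<K)) ⟩
          eval (suc K) (F (suc K)) x + x ^ suc K * E  ≈⟨ eval-+ m (suc K) (F (suc K)) x ⟨
          eval (m ℕ.+ suc K) (F (suc K)) x          ≡⟨ ≡.cong (λ m → eval (m ℕ.+ suc K) (F (suc K)) x) length-as ⟨
          -- The product is a polynomial of degree below m + `suc K`, so this is its full value, and
          -- one of its factors vanishes at x.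
          eval (length as ℕ.+ suc K) (F (suc K)) x  ≈⟨ eval-∏T-root (truncate-Supp g) (coprime-power-inverse ζ₀-primitive x-primitive) ⟩
          0#                                        ∎

      W : Matrix m
      W a i = fromℕ⁻¹ n′ * sum {n} (λ K → h (toℕ K) (toℕ a) * ζ ρ i ^ suc (toℕ K))

      module _ (l i : Fin m) where
        -- `x * u` is definitionally `x ^ n`, so u is the inverse of ζₗ and z is the ratio ζᵢ / ζₗ.
        -- It is an n-th root of unity, and equals 1 only for l = i.
        x u z : ℂ
        x = ζ ρ l
        u = x ^ n′
        z = ζ ρ i * u

        x*u≈1 : x * u ≈ 1#
        x*u≈1 = proj₁ (primitivity ρ l)

        h≈u^K : ∀ K → eval m (h K) x ≈ u ^ suc K
        h≈u^K K = begin
          eval m (h K) x                            ≈⟨ *-identityˡ _ ⟨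
          1# * eval m (h K) x                       ≈⟨ *-congʳ (1^k≈1 (suc K)) ⟨
          1# ^ suc K * eval m (h K) x               ≈⟨ *-congʳ (^-congˡ (suc K) x*u≈1) ⟨
          (x * u) ^ suc K * eval m (h K) x          ≈⟨ *-congʳ (^-distrib-* x u (suc K)) ⟩
          x ^ suc K * u ^ suc K * eval m (h K) x    ≈⟨ solve 3 (λ a b c → a :* b :* c := b :* (a :* c)) refl (x ^ suc K) (u ^ suc K) (eval m (h K) x) ⟩
          u ^ suc K * (x ^ suc K * eval m (h K) x)  ≈⟨ *-congˡ (x^K*h≈1 K (primitivity ρ l)) ⟩
          u ^ suc K * 1#                            ≈⟨ *-identityʳ _ ⟩
          u ^ suc K                                 ∎

        z^n≈1 : z ^ n ≈ 1#
        z^n≈1 = begin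
          (ζ ρ i * u) ^ n          ≈⟨ ^-distrib-* (ζ ρ i) u n ⟩
          ζ ρ i ^ n * u ^ n        ≈⟨ *-cong (proj₁ (primitivity ρ i)) (^-assocʳ x n′ n) ⟩
          1# * x ^ (n′ ℕ.* n)      ≈⟨ *-identityˡ _ ⟩
          x ^ (n′ ℕ.* n)           ≡⟨ ≡.cong (x ^_) (ℕ.*-comm n′ n) ⟩
          x ^ (n ℕ.* n′)           ≈⟨ ^-assocʳ x n n′ ⟨
          (x ^ n) ^ n′             ≈⟨ ^-congˡ n′ x*u≈1 ⟩
          1# ^ n′                  ≈⟨ 1^k≈1 n′ ⟩
          1#                       ∎

        z≈1⇒l≡i : z ≈ 1# → l ≡ i
        z≈1⇒l≡i z≈1 = distinct ρ (begin
          x                  ≈⟨ *-identityˡ x ⟨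
          1# * x             ≈⟨ *-congʳ z≈1 ⟨
          (ζ ρ i * u) * x    ≈⟨ solve 3 (λ y u x → y :* u :* x := y :* (x :* u)) refl (ζ ρ i) u x ⟩
          ζ ρ i * (x * u)    ≈⟨ *-congˡ x*u≈1 ⟩
          ζ ρ i * 1#         ≈⟨ *-identityʳ _ ⟩
          ζ ρ i              ∎)

        VW≈geometric : (V ρ *ᴹ W) l i ≈ fromℕ⁻¹ n′ * sum {n} (λ K → z ^ suc (toℕ K))
        VW≈geometric = begin
          sum {m} (λ a → x ^ toℕ a * (c * sum {n} (λ K → h (toℕ K) (toℕ a) * y K)))
            ≈⟨ sum-cong-≋ {m} (λ a → trans
                 (solve 3 (λ p c s → p :* (c :* s) := c :* (p :* s)) refl (x ^ toℕ a) c (sum {n} (λ K → h (toℕ K) (toℕ a) * y K)))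
                 (*-congˡ (trans (*-distribˡ-sum {n} (x ^ toℕ a) (λ K → h (toℕ K) (toℕ a) * y K))
                   (sum-cong-≋ {n} (λ K → solve 3 (λ p h y → p :* (h :* y) := y :* (h :* p)) refl (x ^ toℕ a) (h (toℕ K) (toℕ a)) (y K)))))) ⟩
          sum {m} (λ a → c * sum {n} (λ K → y K * (h (toℕ K) (toℕ a) * x ^ toℕ a)))
            ≈⟨ *-distribˡ-sum {m} c (λ a → sum {n} (λ K → y K * (h (toℕ K) (toℕ a) * x ^ toℕ a))) ⟨
          c * sum {m} (λ a → sum {n} (λ K → y K * (h (toℕ K) (toℕ a) * x ^ toℕ a)))
            ≈⟨ *-congˡ (∑-comm {m} {n} (λ a K → y K * (h (toℕ K) (toℕ a) * x ^ toℕ a))) ⟩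
          c * sum {n} (λ K → sum {m} (λ a → y K * (h (toℕ K) (toℕ a) * x ^ toℕ a)))
            ≈⟨ *-congˡ (sum-cong-≋ {n} (λ K → begin
                 sum {m} (λ a → y K * (h (toℕ K) (toℕ a) * x ^ toℕ a))
                   ≈⟨ *-distribˡ-sum {m} (y K) (λ a → h (toℕ K) (toℕ a) * x ^ toℕ a) ⟨
                 y K * sum {m} (λ a → h (toℕ K) (toℕ a) * x ^ toℕ a)
                   ≈⟨ *-congˡ (eval≈sum m (h (toℕ K)) x) ⟨
                 y K * eval m (h (toℕ K)) x
                   ≈⟨ *-congˡ (h≈u^K (toℕ K)) ⟩
                 y K * u ^ suc (toℕ K)
                   ≈⟨ ^-distrib-* (ζ ρ i) u (suc (toℕ K)) ⟨
                 z ^ suc (toℕ K)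
                   ∎)) ⟩
          c * sum {n} (λ K → z ^ suc (toℕ K))
            ∎
          where
          c = fromℕ⁻¹ n′
          y : Fin n → ℂ
          y K = ζ ρ i ^ suc (toℕ K)

      V*W≈1 : V ρ *ᴹ W ≈ᴹ 1ᴹ
      V*W≈1 l i = trans (VW≈geometric l i) (lemma (l Fin.≟ i))
        where
        lemma : Dec (l ≡ i) → fromℕ⁻¹ n′ * sum {n} (λ K → z l i ^ suc (toℕ K)) ≈ 1ᴹ l i
        lemma l≟i with l Fin.≟ i
        ... | yes ≡.refl = begin
          fromℕ⁻¹ n′ * sum {n} (λ K → z l l ^ suc (toℕ K))
            ≈⟨ *-congˡ (sum-cong-≋ {n} (λ K → trans (^-congˡ (suc (toℕ K)) (x*u≈1 l l)) (1^k≈1 (suc (toℕ K))))) ⟩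
          fromℕ⁻¹ n′ * sum {n} (λ _ → 1#)        ≈⟨ *-congˡ (sum-ones n) ⟩
          fromℕ⁻¹ n′ * (fromℕ n +i ℝF.0#)        ≈⟨ fromℕ⁻¹-inverse n′ ⟩
          1#                                      ∎
        ... | no l≢i = trans
          (*-congˡ (geometric-sum ℂ-noZeroDivisors {n} (z^n≈1 l i) (l≢i ∘ z≈1⇒l≡i l i))) (zeroʳ _)

      -- That a right inverse is also a left inverse is shown by interpolation. Column b of W V - 1
      -- is the coefficient vector of a polynomial of degree below m; its values at the ζₗ form a
      -- column of V (W V - 1) = (V W) V - V = 0, so it vanishes at m distinct points.
      W*V≈1 : W *ᴹ V ρ ≈ᴹ 1ᴹ
      W*V≈1 a b = x-y≈0⇒x≈y ℂ-noZeroDivisors (trans (sym (extend-toℕ v a))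
        (eval≈0⇒≋𝟘 ℂ-noZeroDivisors (ζ ρ) (λ i → ζ ρ i ^ n′)
          (λ i → trans (*-comm _ _) (x*u≈1 i i)) (distinct ρ) (Supp-extend v) roots (toℕ a)))
        where
        v : Fin m → ℂ
        v a = (W *ᴹ V ρ) a b - 1ᴹ a b
        roots : ∀ l → eval m (extend v) (ζ ρ l) ≈ 0#
        roots l = begin
          eval m (extend v) (ζ ρ l)
            ≈⟨ eval≈sum m (extend v) (ζ ρ l) ⟩
          sum {m} (λ a → extend v (toℕ a) * V ρ l a)
            ≈⟨ sum-cong-≋ {m} (λ a → trans (*-congʳ (extend-toℕ v a))
                 (solve 3 (λ p q r → (p :- q) :* r := p :* r :- q :* r) refl ((W *ᴹ V ρ) a b) (1ᴹ a b) (V ρ l a))) ⟩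
          sum {m} (λ a → (W *ᴹ V ρ) a b * V ρ l a - 1ᴹ a b * V ρ l a)
            ≈⟨ sum-- {m} (λ a → (W *ᴹ V ρ) a b * V ρ l a) (λ a → 1ᴹ a b * V ρ l a) ⟩
          sum {m} (λ a → (W *ᴹ V ρ) a b * V ρ l a) - sum {m} (λ a → 1ᴹ a b * V ρ l a)
            ≈⟨ +-cong VWV≈V (-‿cong (trans (sum-cong-≋ {m} (λ a → *-congʳ (indicator-sym a b))) (sum-indicatorˡ b (V ρ l)))) ⟩
          V ρ l b - V ρ l b
            ≈⟨ -‿inverseʳ _ ⟩
          0#
            ∎
          where
          VWV≈V : sum {m} (λ a → (W *ᴹ V ρ) a b * V ρ l a) ≈ V ρ l b
          VWV≈V = begin
            sum {m} (λ a → sum {m} (λ i → W a i * V ρ i b) * V ρ l a)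
              ≈⟨ sum-cong-≋ {m} (λ a → trans (*-distribʳ-sum {m} (V ρ l a) (λ i → W a i * V ρ i b))
                   (sum-cong-≋ {m} (λ i → solve 3 (λ w p q → w :* p :* q := q :* w :* p) refl (W a i) (V ρ i b) (V ρ l a)))) ⟩
            sum {m} (λ a → sum {m} (λ i → V ρ l a * W a i * V ρ i b))
              ≈⟨ ∑-comm {m} {m} (λ a i → V ρ l a * W a i * V ρ i b) ⟩
            sum {m} (λ i → sum {m} (λ a → V ρ l a * W a i * V ρ i b))
              ≈⟨ sum-cong-≋ {m} (λ i → *-distribʳ-sum {m} (V ρ i b) (λ a → V ρ l a * W a i)) ⟨
            sum {m} (λ i → (V ρ *ᴹ W) l i * V ρ i b)
              ≈⟨ sum-cong-≋ {m} (λ i → *-congʳ (V*W≈1 l i)) ⟩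
            sum {m} (λ i → 1ᴹ l i * V ρ i b)
              ≈⟨ sum-indicatorˡ l (λ i → V ρ i b) ⟩
            V ρ l b
              ∎

      normSq-ζ^ : ∀ i k → normSq (ζ ρ i ^ k) ≤ ℝF.1#
      normSq-ζ^ i k = normSq-root-of-unity n′ (begin
        (ζ ρ i ^ k) ^ n      ≈⟨ ^-assocʳ (ζ ρ i) k n ⟩
        ζ ρ i ^ (k ℕ.* n)    ≡⟨ ≡.cong (ζ ρ i ^_) (ℕ.*-comm k n) ⟩
        ζ ρ i ^ (n ℕ.* k)    ≈⟨ ^-assocʳ (ζ ρ i) n k ⟨
        (ζ ρ i ^ n) ^ k      ≈⟨ ^-congˡ k (proj₁ (primitivity ρ i)) ⟩
        1# ^ k               ≈⟨ 1^k≈1 k ⟩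
        1#                   ∎)

      W≤□ : ∀ a i → W a i ≤□ H ℕ.+ H
      W≤□ a i = fromℕ⁻¹*≤□ n′ (sum-≤□ {n} (λ K → h (toℕ K) (toℕ a) * ζ ρ i ^ suc (toℕ K))
        (λ K → *≤□ (h≤H K a) (normSq-ζ^ i (suc (toℕ K)))))

    V-invertible : Invertible (V ρ)
    V-invertible = W , V*W≈1 , W*V≈1

    Cond-V≤ : ∀ {k} → ω n ℕ.≤ k →
              Cond (V ρ) V-invertible ≤ fromℕ (4 ℕ.^ (1 ℕ.+ 2 ℕ.^ k) ℕ.* n ℕ.^ (2 ℕ.^ k ℕ.+ 2))
    Cond-V≤ {k} ω≤k =
      ℝF.≤-trans (ℝF.*-mono-≤ (proj₁ ‖W‖) (ℝF.0≤fromℕ (m ℕ.* 1)) (proj₂ ‖V‖) (proj₂ ‖W‖)) $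
      ℝF.≤-trans (ℝF.≤-reflexive (ℝF.sym (ℝF.fromℕ-* (m ℕ.* 1) (m ℕ.* (2 ℕ.* (H ℕ.+ H)))))) $
      ℝF.fromℕ-mono-≤ total
      where
      ‖V‖ = ‖‖-bounds (V ρ) {1} (λ i j → ℝF.≤-respʳ-≈
        (ℝF.sym (ℝF.trans (ℝF.*-cong ℝF.fromℕ-1 ℝF.fromℕ-1) (ℝF.*-identityˡ ℝF.1#))) (normSq-ζ^ i (toℕ j)))
      ‖W‖ = ‖‖-bounds W {2 ℕ.* (H ℕ.+ H)} (λ a i → ≤□⇒normSq≤ (W≤□ a i))
      total : m ℕ.* 1 ℕ.* (m ℕ.* (2 ℕ.* (H ℕ.+ H))) ℕ.≤ 4 ℕ.^ (1 ℕ.+ 2 ℕ.^ k) ℕ.* n ℕ.^ (2 ℕ.^ k ℕ.+ 2)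
      total = condition-number-bound n (φ≤ n) (≡.trans (≡.cong (α (ω n) ℕ.*_) (ℕ.*-identityʳ (β (ω n)))) (α*β (ω n))) ω≤k

-- Polynomial bounds for the condition number

corollary3p11 : ∀ {ℓ p : Level} (R : CompleteOrderedField ℓ) →
    let open Cyclotomic R in
    (k : ℕ) → 1 ℕ.≤ k →
    ( ∃[ C ] ∃[ c ] (0# < C) × (0# < c) ×
    ( ∀ n → 2 ℕ.≤ n → ω n ℕ.≤ k → (ρ : PrimitiveRoots n) →
    Σ[ V⁻¹ ∈ Invertible (V ρ) ]
    Cond (V ρ) V⁻¹ ≤ C * (fromℕ n ^ʳ c) ) )
    ×
    ( (F : Pred ℕ p) → (∀ n → F n → (2 ℕ.≤ n) × (ω n ℕ.≤ k)) →
    (r : ℝ) → 0# ≤ r →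
    ( ∃[ C ] ∀ n → F n → (ρ : PrimitiveRoots n) →
    A ρ ≤ C * (fromℕ n ^ʳ r) ) →
    ( ∃[ C ] ∀ n → F n → (ρ : PrimitiveRoots n) →
    Σ[ V⁻¹ ∈ Invertible (V ρ) ]
    Cond (V ρ) V⁻¹ ≤ C * (fromℕ n ^ʳ (fromℕ (2 ℕ.^ k ℕ.+ k ℕ.+ 3) + r)) ) )
corollary3p11 R k _ =
  -- Both parts rest on the estimate `bound` with the same constant C. It holds for every real
  -- exponent from E on: part (1) takes E itself, part (2) takes E + r with r ≥ 0.
  (C , fromℕ E , fromℕ-mono-< {0} (ℕ.m^n>0 4 (1 ℕ.+ 2 ℕ.^ k)) , fromℕ-mono-< {0} (ℕ.m≤n⇒m≤o+n (2 ℕ.^ k ℕ.+ k) (s≤s z≤n)) ,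
    λ n 2≤n ω≤k ρ → bound n (fromℕ E) ≤-refl 2≤n ω≤k ρ) ,
  λ F F⇒ r 0≤r _ → C , λ n Fn ρ →
    bound n (fromℕ E + r) (≤-respˡ-≈ (+-identityʳ _) (+-monoʳ-≤ (fromℕ E) 0≤r)) (proj₁ (F⇒ n Fn)) (proj₂ (F⇒ n Fn)) ρ
  where
  open OrderedField R
  open ComplexNumbers R using (^≤^ʳ)
  open VandermondeInverse R using (V-invertible; Cond-V≤)
  open Cyclotomic R using (PrimitiveRoots; Invertible; V; Cond; _^ʳ_)
  open ≤-Reasoning

  E : ℕ
  E = 2 ℕ.^ k ℕ.+ k ℕ.+ 3

  C : ℝ
  C = fromℕ (4 ℕ.^ (1 ℕ.+ 2 ℕ.^ k))

  2^k+2≤E : 2 ℕ.^ k ℕ.+ 2 ℕ.≤ E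
  2^k+2≤E = ℕ.+-mono-≤ (ℕ.m≤m+n (2 ℕ.^ k) k) (ℕ.n≤1+n 2)

  bound : ∀ n c → fromℕ E ≤ c → 2 ℕ.≤ n → ω n ℕ.≤ k → (ρ : PrimitiveRoots n) →
          Σ[ V⁻¹ ∈ Invertible (V ρ) ] Cond (V ρ) V⁻¹ ≤ C * (fromℕ n ^ʳ c)
  bound n@(suc _) c E≤c 2≤n ω≤k ρ = V-invertible ρ , (begin
    Cond (V ρ) (V-invertible ρ)
      ≤⟨ Cond-V≤ ρ ω≤k ⟩
    fromℕ (4 ℕ.^ (1 ℕ.+ 2 ℕ.^ k) ℕ.* n ℕ.^ (2 ℕ.^ k ℕ.+ 2))
      ≤⟨ fromℕ-mono-≤ (ℕ.*-monoʳ-≤ (4 ℕ.^ (1 ℕ.+ 2 ℕ.^ k)) (ℕ.^-monoʳ-≤ n 2^k+2≤E)) ⟩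
    fromℕ (4 ℕ.^ (1 ℕ.+ 2 ℕ.^ k) ℕ.* n ℕ.^ E)
      ≈⟨ trans (fromℕ-* (4 ℕ.^ (1 ℕ.+ 2 ℕ.^ k)) (n ℕ.^ E)) (*-congˡ (fromℕ-^ n E)) ⟩
    C * fromℕ n ^ E
      ≤⟨ *-mono-≤ (0≤x^k E (0≤fromℕ n)) (0≤fromℕ (4 ℕ.^ (1 ℕ.+ 2 ℕ.^ k))) ≤-refl (^≤^ʳ E 1≤n E≤c) ⟩
    C * (fromℕ n ^ʳ c)
      ∎)
    where
    1≤n : 1# ≤ fromℕ n
    1≤n = ≤-respˡ-≈ fromℕ-1 (fromℕ-mono-≤ (ℕ.<⇒≤ 2≤n))
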